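{- Let $L$ be a BL-algebra and $A=MV(L)$ its MV-center. The map $G_A\to G_L$, $[\mathbf{a},\mathbf{b}]\mapsto[\mathbf{a},\mathbf{b}]$ (good sequences of $A$ are good sequences of $L$) identifies the Chang group $G_A$ of $A$ with the subgroup $\{[\mathbf{a},\mathbf{b}]\in G_L:\mathbf{a},\mathbf{b}\in M_A\}$ of $G_L$. With this identification, $G_A$ is a direct summand of $G_L$: there is a subgroup $S$ of $G_L$ with $G_L=G_A\oplus S$ (internal direct sum of groups), and this complement $S$ is an ideal of the $\ell$-group $G_L$, i.e. a convex $\ell$-subgroup.
   Context: A BL-algebra is an algebra $(L,\wedge,\vee,\otimes,\to,0,1)$ such that $(L,\wedge,\vee,0,1)$ is a bounded lattice, $(L,\otimes,1)$ is a commutative monoid, $x\otimes y\le z$ iff $x\le y\to z$, $x\wedge y=x\otimes(x\to y)$, and $(x\to y)\vee(y\to x)=1$. Put $\bar x=x\to 0$, $x\oslash y=\bar x\to y$, and $x+y=(x\oslash y)\wedge(y\oslash x)$ (commutative, associative, identity $0$). The MV-center of $L$ is $MV(L)=\{\bar x:x\in L\}$, a subalgebra of $L$ which is an MV-algebra. A good sequence of a BL-algebra $L$ is a sequence $\mathbf{a}=(a_1,a_2,\ldots)$ in $L$ with $a_i+a_{i+1}=a_i$ for all $i$ and $a_r=0$ for all large $r$. The sum of sequences is $\mathbf{a}+\mathbf{b}=(c_i)$ with $c_i=a_i+(a_{i-1}\otimes b_1)+\cdots+(a_1\otimes b_{i-1})+b_i$. $M_L$ is the commutative monoid of good sequences of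 $L$ (identity $(0)$), ordered componentwise. The Chang group $G_L=(M_L\times M_L)/\sim$ where $(\mathbf{a},\mathbf{b})\sim(\mathbf{c},\mathbf{d})$ iff $\mathbf{a}+\mathbf{d}+\mathbf{k}=\mathbf{b}+\mathbf{c}+\mathbf{k}$ for some $\mathbf{k}\in M_L$; classes are written $[\mathbf{a},\mathbf{b}]$, with $[\mathbf{a},\mathbf{b}]+[\mathbf{c},\mathbf{d}]=[\mathbf{a}+\mathbf{c},\mathbf{b}+\mathbf{d}]$ and order $[\mathbf{a},\mathbf{b}]\preceq[\mathbf{c},\mathbf{d}]$ iff $\mathbf{a}+\mathbf{d}+\mathbf{k}\le\mathbf{b}+\mathbf{c}+\mathbf{k}$ for some $\mathbf{k}\in M_L$; $(G_L,\preceq)$ is a lattice-ordered Abelian group. $G_A$, $M_A$ are defined in the same way for the BL-algebra $A$. -}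

module Defs where

open import Level using (Level; _⊔_) renaming (suc to lsuc)
open import Data.Nat using (ℕ; zero; suc; _∸_) renaming (_≤_ to _≤ℕ_)
open import Data.List using (List; map; foldl; upTo; _++_; [_])
open import Data.Product using (Σ; ∃; ∃-syntax; _×_; _,_; proj₁; proj₂)
open import Relation.Binary.PropositionalEquality using (_≡_)
open import Algebra.Lattice.Structures using (IsLattice)
open import Algebra.Structures using (IsCommutativeMonoid)
open import Function.Bundles using (_⇔_)

record BLAlgebra (c : Level) : Set (lsuc c) where
  infixr 7 _∧_
  infixr 6 _∨_
  infixl 7 _⊗_
  infixr 5 _⇒_
  infix 4 _≤_
  field
    Carrier : Set c
    _∧_ _∨_ _⊗_ _⇒_ : Carrier → Carrier → Carrier
    𝟘 𝟙 : Carrier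

  _≤_ : Carrier → Carrier → Set c
  x ≤ y = x ∧ y ≡ x

  field
    isLattice : IsLattice _≡_ _∨_ _∧_
    bottom    : ∀ x → 𝟘 ≤ x
    top       : ∀ x → x ≤ 𝟙
    isCommutativeMonoid : IsCommutativeMonoid _≡_ _⊗_ 𝟙
    residuation : ∀ x y z → ((x ⊗ y) ≤ z) ⇔ (x ≤ (y ⇒ z))
    divisibility : ∀ x y → x ∧ y ≡ x ⊗ (x ⇒ y)
    prelinearity : ∀ x y → (x ⇒ y) ∨ (y ⇒ x) ≡ 𝟙

module BLDefs {c : Level} (L : BLAlgebra c) where
  open BLAlgebra L

  ‾_ : Carrier → Carrier
  ‾ x = x ⇒ 𝟘

  _⊘_ : Carrier → Carrier → Carrier
  x ⊘ y = (‾ x) ⇒ y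

  infixl 6 _+_
  _+_ : Carrier → Carrier → Carrier
  x + y = (x ⊘ y) ∧ (y ⊘ x)

  InA : Carrier → Set c
  InA x = ∃[ y ] (x ≡ ‾ y)

  -- Sequences. Convention: index i : ℕ stores the paper's a_{i+1}.
  Seq : Set c
  Seq = ℕ → Carrier

  IsGood : Seq → Set c
  IsGood a = (∀ i → a i + a (suc i) ≡ a i)
           × (∃[ N ] (∀ r → N ≤ℕ r → a r ≡ 𝟘))

  InMA : Seq → Set c
  InMA a = IsGood a × (∀ i → InA (a i))

  zeroSeq : Seq
  zeroSeq _ = 𝟘

  -- sum of sequences: c_i = a_i + (a_{i-1}⊗b_1) + ... + (a_1⊗b_{i-1}) + b_i
  -- (paper's 1-based index i = n+1; the middle terms are for j = 1..n,
  --  a_{i-j} ⊗ b_j, i.e. a (n ∸ suc k) ⊗ b k for k = j-1 = 0..n-1),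
  -- summed left to right.
  infixl 6 _⊕_
  _⊕_ : Seq → Seq → Seq
  (a ⊕ b) n = foldl _+_ (a n) (map (λ k → a (n ∸ suc k) ⊗ b k) (upTo n) ++ [ b n ])

  _≤ˢ_ : Seq → Seq → Set c
  a ≤ˢ b = ∀ i → a i ≤ b i

  _≡ˢ_ : Seq → Seq → Set c
  a ≡ˢ b = ∀ i → a i ≡ b i

  -- pairs of sequences (representatives of elements of the Chang group)
  Pair : Set c
  Pair = Seq × Seq

  GoodPair : Pair → Set c
  GoodPair (a , b) = IsGood a × IsGood b

  InGA : Pair → Set c
  InGA (a , b) = InMA a × InMA b

  _+ᴾ_ : Pair → Pair → Pair
  (a , b) +ᴾ (c' , d) = (a ⊕ c' , b ⊕ d)

  -ᴾ_ : Pair → Pair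
  -ᴾ (a , b) = (b , a)

  0ᴾ : Pair
  0ᴾ = (zeroSeq , zeroSeq)

  _∼_ : Pair → Pair → Set c
  (a , b) ∼ (c' , d) = ∃[ k ] (IsGood k × (((a ⊕ d) ⊕ k) ≡ˢ ((b ⊕ c') ⊕ k)))

  _∼A_ : Pair → Pair → Set c
  (a , b) ∼A (c' , d) = ∃[ k ] (InMA k × (((a ⊕ d) ⊕ k) ≡ˢ ((b ⊕ c') ⊕ k)))

  _⪯_ : Pair → Pair → Set c
  (a , b) ⪯ (c' , d) = ∃[ k ] (IsGood k × (((a ⊕ d) ⊕ k) ≤ˢ ((b ⊕ c') ⊕ k)))

  IsSup : Pair → Pair → Pair → Set c
  IsSup z x y = x ⪯ z × y ⪯ z × (∀ w → GoodPair w → x ⪯ w → y ⪯ w → z ⪯ w)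

  IsInf : Pair → Pair → Pair → Set c
  IsInf z x y = z ⪯ x × z ⪯ y × (∀ w → GoodPair w → w ⪯ x → w ⪯ y → w ⪯ z)

  -- A predicate S on representatives describes a subgroup of G_L
  IsSubgroup : (Pair → Set c) → Set c
  IsSubgroup S =
      (∀ x y → GoodPair x → GoodPair y → x ∼ y → S x → S y)
    × S 0ᴾ
    × (∀ x y → GoodPair x → GoodPair y → S x → S y → S (x +ᴾ y))
    × (∀ x → GoodPair x → S x → S (-ᴾ x))

  IsComplementOfGA : (Pair → Set c) → Set c
  IsComplementOfGA S =
      (∀ x → GoodPair x →
         ∃[ y ] ∃[ z ] (InGA y × GoodPair z × S z × (x ∼ (y +ᴾ z))))
    × (∀ x → InGA x → S x → x ∼ 0ᴾ)

  IsSublattice : (Pair → Set c) → Set c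
  IsSublattice S =
      (∀ x y z → GoodPair x → GoodPair y → GoodPair z →
         S x → S y → IsSup z x y → S z)
    × (∀ x y z → GoodPair x → GoodPair y → GoodPair z →
         S x → S y → IsInf z x y → S z)

  IsConvex : (Pair → Set c) → Set c
  IsConvex S =
    ∀ x y z → GoodPair x → GoodPair y → GoodPair z →
      S x → S z → x ⪯ y → y ⪯ z → S y

  IsIdeal : (Pair → Set c) → Set c
  IsIdeal S = IsSubgroup S × IsSublattice S × IsConvex S

{-# OPTIONS --safe #-}

-- Double negation φ is a homomorphism of L onto its MV-center A that fixes A, so it acts on
-- good sequences, and the complement of G_A is the kernel {[a,b] : φ a = φ b} of the induced
-- retraction. Every x factors as φ x ⊗ δ x with δ x = φ x → x dense; if s is the product of
-- the δ aᵢ, then φ a + (s) = (1) + a, which gives [a,b] = [φ a, φ b] + [(s), (t)] as well as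
-- upper bounds [(1), (s)] inside the kernel.
--
-- Addition of good sequences is associative over A but not over L: in the chain
-- 0 < h < d < 1 with h ⊗ h = 0, d ⊗ h = h, d ⊗ d = d one has ((d) + (h)) + (h) = (1,1) and
-- (d) + ((h) + (h)) = (1,d). Hence associativity and cancellation are applied only to images
-- under φ, and ∼ is never used as a transitive relation.
--
-- Case distinctions valid in chains are made constructively: if q ∨ r = 1, an inequality that
-- holds modulo the filters generated by q and by r holds.
module Submission where

open import Defs
open import Algebra.Bundles using (CommutativeMonoid)
open import Algebra.Lattice.Bundles using (Lattice)
import Algebra.Lattice.Properties.Lattice as LatticeProperties
open import Algebra.Lattice.Structures using (IsLattice)
import Algebra.Properties.CommutativeSemigroup as CommutativeSemigroupProperties
open import Algebra.Structures using (IsCommutativeMonoid)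
open import Data.List using (foldl; map; upTo; _++_; [_])
open import Data.List.Properties using (map-upTo; map-applyUpTo)
open import Data.Nat using (ℕ; zero; suc; _∸_; z≤n; s≤s) renaming (_+_ to _+ℕ_; _≤_ to _≤ℕ_)
open import Data.Nat.Properties using (m≤n+m; m≤n⇒m≤1+n) renaming (≤-trans to ≤ℕ-trans)
open import Data.Product using (Σ; _×_; _,_; proj₁; proj₂)
open import Data.Unit using (⊤)
open import Function.Bundles using (_⇔_; Equivalence; mk⇔)
import Relation.Binary.Lattice.Structures as OrderLattice
open import Relation.Binary.PropositionalEquality
  using (_≡_; refl; sym; trans; cong; cong₂; subst; subst₂; _→-setoid_; module ≡-Reasoning)
import Relation.Binary.Reasoning.Setoid as SetoidReasoning

module GoodSequences {c} (L : BLAlgebra c) where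
  open BLAlgebra L
  open BLDefs L
  open IsLattice isLattice using (∧-comm)
  open IsCommutativeMonoid isCommutativeMonoid using ()
    renaming (assoc to ⊗-assoc; comm to ⊗-comm; identityˡ to ⊗-identityˡ; identityʳ to ⊗-identityʳ)

  -- Order and residuation in `L`.

  ⊗-commutativeMonoid : CommutativeMonoid c c
  ⊗-commutativeMonoid = record { isCommutativeMonoid = isCommutativeMonoid }

  lattice : Lattice c c
  lattice = record { isLattice = isLattice }

  open CommutativeSemigroupProperties (CommutativeMonoid.commutativeSemigroup ⊗-commutativeMonoid)
    using (xy∙z≈xz∙y; xy∙z≈zy∙x; interchange)
  private
    module Lat = OrderLattice.IsLattice
      (LatticeProperties.∨-∧-isOrderTheoreticLattice lattice)

  ≤-refl : ∀ {x} → x ≤ x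
  ≤-refl = sym Lat.refl

  ≤-trans : ∀ {x y z} → x ≤ y → y ≤ z → x ≤ z
  ≤-trans x≤y y≤z = sym (Lat.trans (sym x≤y) (sym y≤z))

  ≤-antisym : ∀ {x y} → x ≤ y → y ≤ x → x ≡ y
  ≤-antisym x≤y y≤x = Lat.antisym (sym x≤y) (sym y≤x)

  ≤-reflexive : ∀ {x y} → x ≡ y → x ≤ y
  ≤-reflexive refl = ≤-refl

  ∨-lub : ∀ {x y z} → x ≤ z → y ≤ z → (x ∨ y) ≤ z
  ∨-lub x≤z y≤z = sym (Lat.∨-least (sym x≤z) (sym y≤z))

  ∧-glb : ∀ {x y z} → x ≤ y → x ≤ z → x ≤ (y ∧ z)
  ∧-glb x≤y x≤z = sym (Lat.∧-greatest (sym x≤y) (sym x≤z))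

  residuate : ∀ {x y z} → (x ⊗ y) ≤ z → x ≤ (y ⇒ z)
  residuate = Equivalence.to (residuation _ _ _)

  unresiduate : ∀ {x y z} → x ≤ (y ⇒ z) → (x ⊗ y) ≤ z
  unresiduate = Equivalence.from (residuation _ _ _)

  ⊗-monoˡ : ∀ {x y} z → x ≤ y → (x ⊗ z) ≤ (y ⊗ z)
  ⊗-monoˡ z x≤y = unresiduate (≤-trans x≤y (residuate ≤-refl))

  ⊗-monoʳ : ∀ {x y} z → x ≤ y → (z ⊗ x) ≤ (z ⊗ y)
  ⊗-monoʳ z x≤y = subst₂ _≤_ (⊗-comm _ z) (⊗-comm _ z) (⊗-monoˡ z x≤y)

  x⊗y≤x : ∀ {x} y → (x ⊗ y) ≤ x
  x⊗y≤x {x} y = subst ((x ⊗ y) ≤_) (⊗-identityʳ x) (⊗-monoʳ x (top y))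

  x⊗y≤y : ∀ x {y} → (x ⊗ y) ≤ y
  x⊗y≤y x {y} = subst (_≤ y) (⊗-comm y x) (x⊗y≤x x)

  -- Inequalities modulo a principal filter.

  pow : Carrier → ℕ → Carrier
  pow p zero = 𝟙
  pow p (suc n) = p ⊗ pow p n

  pow-+ : ∀ p m n → pow p (m +ℕ n) ≡ pow p m ⊗ pow p n
  pow-+ p zero n = sym (⊗-identityˡ _)
  pow-+ p (suc m) n = trans (cong (p ⊗_) (pow-+ p m n)) (sym (⊗-assoc p _ _))

  pow-⊗ : ∀ p q n → pow (p ⊗ q) n ≡ pow p n ⊗ pow q n
  pow-⊗ p q zero = sym (⊗-identityˡ 𝟙)
  pow-⊗ p q (suc n) = trans (cong ((p ⊗ q) ⊗_) (pow-⊗ p q n)) (interchange p q _ _)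

  -- x lies below y modulo the filter generated by p.
  infix 3 _⊢_≼_
  record _⊢_≼_ (p x y : Carrier) : Set c where
    constructor power
    field
      exponent : ℕ
      bound : (pow p exponent ⊗ x) ≤ y

  private variable
    p q r x y z x′ y′ : Carrier

  raise : ∀ m n → (pow p n ⊗ x) ≤ y → (pow p (m +ℕ n) ⊗ x) ≤ y
  raise {p} {x} m n h = ≤-trans (⊗-monoˡ x (subst (_≤ pow p n) (sym (pow-+ p m n)) (x⊗y≤y _))) h

  raiseʳ : ∀ m n → (pow p n ⊗ x) ≤ y → (pow p (n +ℕ m) ⊗ x) ≤ y
  raiseʳ {p} {x} m n h = ≤-trans (⊗-monoˡ x (subst (_≤ pow p n) (sym (pow-+ p n m)) (x⊗y≤x _))) h

  lift : x ≤ y → p ⊢ x ≼ y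
  lift x≤y = power 0 (subst (_≤ _) (sym (⊗-identityˡ _)) x≤y)

  pow-𝟙 : ∀ n → pow 𝟙 n ≡ 𝟙
  pow-𝟙 zero = refl
  pow-𝟙 (suc n) = trans (⊗-identityˡ _) (pow-𝟙 n)

  exact : 𝟙 ⊢ x ≼ y → x ≤ y
  exact {x} {y} (power n h) = subst (_≤ y) (trans (cong (_⊗ x) (pow-𝟙 n)) (⊗-identityˡ x)) h

  ≼-refl : p ⊢ x ≼ x
  ≼-refl = lift ≤-refl

  ≡⇒≼ : x ≡ y → p ⊢ x ≼ y
  ≡⇒≼ refl = ≼-refl

  infixr 2 _⨟_
  _⨟_ : p ⊢ x ≼ y → p ⊢ y ≼ z → p ⊢ x ≼ z
  _⨟_ {p} {x} {y} {z} (power n h) (power m k) = power (m +ℕ n)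
    (≤-trans (≤-reflexive (trans (cong (_⊗ x) (pow-+ p m n)) (⊗-assoc _ _ x)))
      (≤-trans (⊗-monoʳ (pow p m) h) k))

  ∧-fst : p ⊢ x ∧ y ≼ x
  ∧-fst = lift (sym (Lat.x∧y≤x _ _))

  ∧-snd : p ⊢ x ∧ y ≼ y
  ∧-snd = lift (sym (Lat.x∧y≤y _ _))

  ∧-intro : p ⊢ x ≼ y → p ⊢ x ≼ z → p ⊢ x ≼ y ∧ z
  ∧-intro (power n h) (power m k) = power (n +ℕ m) (∧-glb (raiseʳ m n h) (raise n m k))

  ∨-inl : p ⊢ x ≼ x ∨ y
  ∨-inl = lift (sym (Lat.x≤x∨y _ _))

  ∨-inr : p ⊢ y ≼ x ∨ y
  ∨-inr = lift (sym (Lat.y≤x∨y _ _))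

  curry : p ⊢ x ⊗ y ≼ z → p ⊢ x ≼ y ⇒ z
  curry (power n h) = power n (residuate (subst (_≤ _) (sym (⊗-assoc _ _ _)) h))

  uncurry : p ⊢ x ≼ y ⇒ z → p ⊢ x ⊗ y ≼ z
  uncurry (power n h) = power n (subst (_≤ _) (⊗-assoc _ _ _) (unresiduate h))

  swap⊗ : p ⊢ x ⊗ y ≼ y ⊗ x
  swap⊗ = ≡⇒≼ (⊗-comm _ _)

  ∨-elim : p ⊢ x ≼ z → p ⊢ y ≼ z → p ⊢ x ∨ y ≼ z
  ∨-elim {p} {x} {z} {y} (power n h) (power m k) = power (n +ℕ m)
    (subst (_≤ z) (⊗-comm _ _) (unresiduate (∨-lub (side (raiseʳ m n h)) (side (raise n m k)))))
    where
    side : ∀ {e u} → (e ⊗ u) ≤ z → u ≤ (e ⇒ z)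
    side h = residuate (subst (_≤ z) (⊗-comm _ _) h)

  ⊗-mono : p ⊢ x ≼ x′ → p ⊢ y ≼ y′ → p ⊢ x ⊗ y ≼ x′ ⊗ y′
  ⊗-mono h k = onLeft h ⨟ swap⊗ ⨟ onLeft k ⨟ swap⊗
    where
    onLeft : ∀ {x x′ y} → p ⊢ x ≼ x′ → p ⊢ x ⊗ y ≼ x′ ⊗ y
    onLeft h = uncurry (h ⨟ curry ≼-refl)

  eval : p ⊢ (x ⇒ y) ⊗ x ≼ y
  eval = uncurry ≼-refl

  evalʳ : p ⊢ x ⊗ (x ⇒ y) ≼ y
  evalʳ = swap⊗ ⨟ eval

  -- The form in which divisibility enters nearly every calculation below.
  divide : p ⊢ x ≼ y → p ⊢ x ≼ y ⊗ (y ⇒ x)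
  divide h = ∧-intro h ≼-refl ⨟ ≡⇒≼ (divisibility _ _)

  ⇒-mono : p ⊢ x′ ≼ x → p ⊢ y ≼ y′ → p ⊢ x ⇒ y ≼ x′ ⇒ y′
  ⇒-mono h k = curry (⊗-mono ≼-refl h ⨟ eval ⨟ k)

  ∧-mono : p ⊢ x ≼ x′ → p ⊢ y ≼ y′ → p ⊢ x ∧ y ≼ x′ ∧ y′
  ∧-mono h k = ∧-intro (∧-fst ⨟ h) (∧-snd ⨟ k)

  ‾-anti : p ⊢ x ≼ y → p ⊢ ‾ y ≼ ‾ x
  ‾-anti h = ⇒-mono h ≼-refl

  +-mono : p ⊢ x ≼ x′ → p ⊢ y ≼ y′ → p ⊢ x + y ≼ x′ + y′
  +-mono h k = ∧-mono (⇒-mono (‾-anti h) k) (⇒-mono (‾-anti k) h)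

  ≼𝟙 : p ⊢ x ≼ 𝟙
  ≼𝟙 = lift (top _)

  𝟘≼ : p ⊢ 𝟘 ≼ x
  𝟘≼ = lift (bottom _)

  ⊗-fst : p ⊢ x ⊗ y ≼ x
  ⊗-fst = lift (x⊗y≤x _)

  ⊗-snd : p ⊢ x ⊗ y ≼ y
  ⊗-snd = lift (x⊗y≤y _)

  ⇒-top : p ⊢ x ≼ y → p ⊢ 𝟙 ≼ x ⇒ y
  ⇒-top h = curry (⊗-snd ⨟ h)

  ⇒-entails : p ⊢ 𝟙 ≼ x ⇒ y → p ⊢ x ≼ y
  ⇒-entails h = ≡⇒≼ (sym (⊗-identityˡ _)) ⨟ uncurry h

  ⇒-unit : p ⊢ 𝟙 ≼ x → p ⊢ x ⇒ y ≼ y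
  ⇒-unit h = ≡⇒≼ (sym (⊗-identityʳ _)) ⨟ ⊗-mono ≼-refl h ⨟ eval

  ⊗-unitˡ : p ⊢ 𝟙 ≼ y → p ⊢ x ≼ y ⊗ x
  ⊗-unitˡ h = ≡⇒≼ (sym (⊗-identityˡ _)) ⨟ ⊗-mono h ≼-refl

  -- Expand `(x ∨ y) ⊗ (x ∨ z)`: every term other than `y ⊗ z` has a factor `x`.
  ∨-⊗-distrib : p ⊢ 𝟙 ≼ x ∨ y → p ⊢ 𝟙 ≼ x ∨ z → p ⊢ 𝟙 ≼ x ∨ (y ⊗ z)
  ∨-⊗-distrib h k =
    ⊗-unitˡ h ⨟ ⊗-mono ≼-refl k ⨟
    uncurry (∨-elim (curry (⊗-fst ⨟ ∨-inl))
      (curry (swap⊗ ⨟ uncurry (∨-elim (curry (⊗-fst ⨟ ∨-inl)) (curry (swap⊗ ⨟ ∨-inr))))))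

  ∨-pow : 𝟙 ⊢ 𝟙 ≼ x ∨ y → ∀ n → 𝟙 ⊢ 𝟙 ≼ x ∨ pow y n
  ∨-pow h zero = ∨-inr
  ∨-pow h (suc n) = ∨-⊗-distrib h (∨-pow h n)

  ∨-swap : p ⊢ x ∨ y ≼ y ∨ x
  ∨-swap = ∨-elim ∨-inr ∨-inl

  -- From `q ∨ r = 𝟙` also `pow q N ∨ pow r N = 𝟙`. With `N` large enough for both hypotheses, each
  -- of these powers lies below `(pow p N ⊗ x) ⇒ y`, hence so does `𝟙`.
  split : q ∨ r ≡ 𝟙 → p ⊗ q ⊢ x ≼ y → p ⊗ r ⊢ x ≼ y → p ⊢ x ≼ y
  split {q} {r} {p} {x} {y} q∨r (power n h) (power m k) = power N
    (subst (_≤ y) (⊗-identityˡ _)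
      (unresiduate (≤-trans (exact q^N∨r^N) (∨-lub (side q (raiseʳ m n h)) (side r (raise n m k))))))
    where
    N = n +ℕ m
    q^N∨r^N : 𝟙 ⊢ 𝟙 ≼ pow q N ∨ pow r N
    q^N∨r^N = ∨-pow (∨-pow (≡⇒≼ (sym q∨r) ⨟ ∨-swap) N ⨟ ∨-swap) N
    side : ∀ s → (pow (p ⊗ s) N ⊗ x) ≤ y → pow s N ≤ ((pow p N ⊗ x) ⇒ y)
    side s h = residuate (subst (_≤ y)
      (trans (cong (_⊗ x) (trans (pow-⊗ p s N) (⊗-comm _ _))) (⊗-assoc _ _ x)) h)

  assume : p ⊗ q ⊢ 𝟙 ≼ q
  assume = power 1 (≤-trans (x⊗y≤x _) (≤-trans (x⊗y≤x _) (x⊗y≤y _)))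

  weaken : p ⊢ x ≼ y → p ⊗ q ⊢ x ≼ y
  weaken {x = x} (power n h) =
    power n (≤-trans (⊗-monoˡ x (subst (_≤ _) (sym (pow-⊗ _ _ n)) (x⊗y≤x _))) h)

  -- Prelinearity as a case distinction: `u` and `v` may be taken to be comparable, as in a chain,
  -- at the cost of enlarging the filter.
  compare : ∀ u v → (p ⊗ (u ⇒ v) ⊢ u ≼ v → p ⊗ (u ⇒ v) ⊢ x ≼ y) →
            (p ⊗ (v ⇒ u) ⊢ v ≼ u → p ⊗ (v ⇒ u) ⊢ x ≼ y) → p ⊢ x ≼ y
  compare u v h k = split (prelinearity u v) (h (⇒-entails assume)) (k (⇒-entails assume))

  equal : 𝟙 ⊢ x ≼ y → 𝟙 ⊢ y ≼ x → x ≡ y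
  equal h k = ≤-antisym (exact h) (exact k)

  -- Double negation as a homomorphism.

  φ : Carrier → Carrier
  φ x = ‾ (‾ x)

  ≼φ : p ⊢ x ≼ φ x
  ≼φ = curry evalʳ

  φ-mono : p ⊢ x ≼ y → p ⊢ φ x ≼ φ y
  φ-mono h = ‾-anti (‾-anti h)

  φ‾ : ∀ x → φ (‾ x) ≡ ‾ x
  φ‾ x = equal (‾-anti ≼φ) ≼φ

  φ𝟙 : φ 𝟙 ≡ 𝟙
  φ𝟙 = equal ≼𝟙 ≼φ

  φ𝟘 : φ 𝟘 ≡ 𝟘
  φ𝟘 = equal (⇒-unit (curry ⊗-snd)) 𝟘≼

  ⇒-swap : p ⊢ x ⇒ (y ⇒ z) ≼ y ⇒ (x ⇒ z)
  ⇒-swap = curry (curry (≡⇒≼ (xy∙z≈xz∙y _ _ _) ⨟ uncurry eval))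

  ‾⊗ : ∀ x y → ‾ (x ⊗ y) ≡ (x ⇒ ‾ y)
  ‾⊗ x y = equal (curry (curry (≡⇒≼ (⊗-assoc _ _ _) ⨟ eval)))
                 (curry (≡⇒≼ (sym (⊗-assoc _ _ _)) ⨟ uncurry eval))

  contrapose : ∀ x y → (x ⇒ ‾ y) ≡ (y ⇒ ‾ x)
  contrapose x y = equal ⇒-swap ⇒-swap

  ‾∧ : p ⊢ ‾ (x ∧ y) ≼ ‾ x ∨ ‾ y
  ‾∧ {x = x} {y = y} = compare x y
    (λ x≼y → ‾-anti (∧-intro ≼-refl x≼y) ⨟ ∨-inl)
    (λ y≼x → ‾-anti (∧-intro y≼x ≼-refl) ⨟ ∨-inr)

  ‾φ⊗ : ∀ x y → ‾ (φ x ⊗ y) ≡ ‾ (x ⊗ y)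
  ‾φ⊗ x y = begin
    ‾ (φ x ⊗ y)   ≡⟨ ‾⊗ (φ x) y ⟩
    (φ x ⇒ ‾ y)   ≡⟨ contrapose (φ x) y ⟩
    (y ⇒ φ (‾ x)) ≡⟨ cong (y ⇒_) (φ‾ x) ⟩
    (y ⇒ ‾ x)     ≡⟨ contrapose y x ⟩
    (x ⇒ ‾ y)     ≡⟨ ‾⊗ x y ⟨
    ‾ (x ⊗ y)     ∎
    where open ≡-Reasoning

  -- φ (x ⊗ y) ≤ φ x, so by divisibility φ (x ⊗ y) equals φ x ⊗ (φ x ⇒ φ (x ⊗ y)).
  φ-⊗ : ∀ x y → φ (x ⊗ y) ≡ φ x ⊗ φ y
  φ-⊗ x y = equal
    (divide (φ-mono ⊗-fst) ⨟ ⊗-mono ≼-refl (quotient ⨟ ‾∧) ⨟ swap⊗ ⨟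
      uncurry (∨-elim (curry (eval ⨟ 𝟘≼)) (curry swap⊗)))
    (≼φ ⨟ ≡⇒≼ (cong ‾_ (begin
      ‾ (φ x ⊗ φ y) ≡⟨ ‾φ⊗ x (φ y) ⟩
      ‾ (x ⊗ φ y)   ≡⟨ cong ‾_ (⊗-comm _ _) ⟩
      ‾ (φ y ⊗ x)   ≡⟨ ‾φ⊗ y x ⟩
      ‾ (y ⊗ x)     ≡⟨ cong ‾_ (⊗-comm _ _) ⟩
      ‾ (x ⊗ y)     ∎)))
    where
    open ≡-Reasoning
    quotient : 𝟙 ⊢ φ x ⇒ φ (x ⊗ y) ≼ ‾ (φ x ∧ ‾ y)
    quotient =
      ⇒-mono ≼-refl (‾-anti (≡⇒≼ (sym (‾⊗ x y)))) ⨟ ≡⇒≼ (sym (‾⊗ (φ x) (x ⇒ ‾ y))) ⨟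
      ‾-anti (≡⇒≼ (divisibility (φ x) (‾ y)) ⨟ ⊗-mono ≼-refl (⇒-mono ≼φ ≼-refl))

  δ : Carrier → Carrier
  δ x = φ x ⇒ x

  φ⊗δ : ∀ x → φ x ⊗ δ x ≡ x
  φ⊗δ x = equal evalʳ (divide ≼φ)

  -- As `‾ x ≤ δ x`, the element `‾ (δ x)` lies below `φ x`. So it equals `φ x ⊗ (φ x ⇒ ‾ (δ x))`,
  -- whose second factor is `‾ (φ x ⊗ δ x) = ‾ x`, and the product is `𝟘`.
  φδ : ∀ x → φ (δ x) ≡ 𝟙
  φδ x = equal ≼𝟙 (⇒-top
    (divide (‾-anti (curry (evalʳ ⨟ 𝟘≼))) ⨟
     ⊗-mono ≼-refl (≡⇒≼ (trans (sym (‾⊗ (φ x) (δ x))) (cong ‾_ (φ⊗δ x)))) ⨟ eval))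

  φ-⇒ : ∀ x y → φ (x ⇒ y) ≡ (φ x ⇒ φ y)
  φ-⇒ x y = equal
    (curry (≡⇒≼ (sym (φ-⊗ _ _)) ⨟ φ-mono eval))
    -- A factor `φ (δ y) = 𝟙` is inserted: under `φ` it becomes `δ y`, which brings the value `φ y`
    -- down to `y`.
    (≼φ ⨟ ≡⇒≼ (sym (⊗-identityʳ _)) ⨟ ≡⇒≼ (cong (φ (φ x ⇒ φ y) ⊗_) (sym (φδ y))) ⨟
     ≡⇒≼ (sym (φ-⊗ _ _)) ⨟
     φ-mono (curry (≡⇒≼ (xy∙z≈xz∙y _ _ _) ⨟
       ⊗-mono (⊗-mono ≼-refl ≼φ ⨟ eval) ≼-refl ⨟ evalʳ)))

  φ-∧ : ∀ x y → φ (x ∧ y) ≡ φ x ∧ φ y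
  φ-∧ x y = begin
    φ (x ∧ y)           ≡⟨ cong φ (divisibility x y) ⟩
    φ (x ⊗ (x ⇒ y))     ≡⟨ φ-⊗ x (x ⇒ y) ⟩
    φ x ⊗ φ (x ⇒ y)     ≡⟨ cong (φ x ⊗_) (φ-⇒ x y) ⟩
    φ x ⊗ (φ x ⇒ φ y)   ≡⟨ divisibility (φ x) (φ y) ⟨
    φ x ∧ φ y           ∎
    where open ≡-Reasoning

  φ-+ : ∀ x y → φ (x + y) ≡ φ x + φ y
  φ-+ x y = trans (φ-∧ _ _) (cong₂ _∧_ (φ-⇒ (‾ x) y) (φ-⇒ (‾ y) x))

  -- The sum of two elements of `L`.

  +-comm : ∀ x y → x + y ≡ y + x
  +-comm x y = ∧-comm _ _

  ‾-unit : p ⊢ 𝟙 ≼ x → p ⊢ ‾ x ≼ 𝟘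
  ‾-unit = ⇒-unit

  ‾-zero : p ⊢ 𝟙 ≼ ‾ x → p ⊢ x ≼ 𝟘
  ‾-zero h = ≼φ ⨟ ⇒-unit h

  +-identityʳ : ∀ x → x + 𝟘 ≡ x
  +-identityʳ x = equal (∧-snd ⨟ ⇒-unit (⇒-top ≼-refl)) (∧-intro ≼φ (curry ⊗-fst))

  +-topˡ : p ⊢ 𝟙 ≼ x → p ⊢ 𝟙 ≼ x + y
  +-topˡ h = ∧-intro (⇒-top (‾-unit h ⨟ 𝟘≼)) (⇒-top (≼𝟙 ⨟ h))

  +-topʳ : p ⊢ 𝟙 ≼ y → p ⊢ 𝟙 ≼ x + y
  +-topʳ h = +-topˡ h ⨟ ≡⇒≼ (+-comm _ _)

  𝟙+ : ∀ x → 𝟙 + x ≡ 𝟙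
  𝟙+ x = equal ≼𝟙 (+-topˡ ≼-refl)

  +𝟙 : ∀ x → x + 𝟙 ≡ 𝟙
  +𝟙 x = equal ≼𝟙 (+-topʳ ≼-refl)

  x≼x+y : p ⊢ x ≼ x + y
  x≼x+y = ≡⇒≼ (sym (+-identityʳ _)) ⨟ +-mono ≼-refl 𝟘≼

  y≼x+y : p ⊢ y ≼ x + y
  y≼x+y = x≼x+y ⨟ ≡⇒≼ (+-comm _ _)

  φ+φ : ∀ x y → φ x + φ y ≡ ‾ (‾ x ⊗ ‾ y)
  φ+φ x y = equal (∧-fst ⨟ ≡⇒≼ (side x y))
    (∧-intro (≡⇒≼ (sym (side x y))) (≡⇒≼ (trans (cong ‾_ (⊗-comm _ _)) (sym (side y x)))))
    where
    side : ∀ x y → (‾ (φ x) ⇒ φ y) ≡ ‾ (‾ x ⊗ ‾ y)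
    side x y = trans (cong (_⇒ φ y) (φ‾ x)) (sym (‾⊗ (‾ x) (‾ y)))

  -- Negation depends only on `φ` of its argument, so this De Morgan law passes from the MV-center
  -- to all of `L`.
  ‾+ : ∀ x y → ‾ (x + y) ≡ ‾ x ⊗ ‾ y
  ‾+ x y = begin
    ‾ (x + y)           ≡⟨ φ‾ (x + y) ⟨
    ‾ (φ (x + y))       ≡⟨ cong ‾_ (trans (φ-+ x y) (φ+φ x y)) ⟩
    φ (‾ x ⊗ ‾ y)       ≡⟨ φ-⊗ (‾ x) (‾ y) ⟩
    φ (‾ x) ⊗ φ (‾ y)   ≡⟨ cong₂ _⊗_ (φ‾ x) (φ‾ y) ⟩
    ‾ x ⊗ ‾ y           ∎
    where open ≡-Reasoning

  -- In a chain: `y = 𝟘` or `x = 𝟙`. By `‾+`, goodness gives `‾ x = ‾ x ⊗ ‾ y` and thus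
  -- `‾ x ∧ y = 𝟘`. If `‾ x ≤ y` and `‾ y ≤ x`, both residuals in `x + y` are `𝟙`, so `x = 𝟙`; the
  -- other cases give `y = 𝟘`.
  good-split : x + y ≡ x → ‾ y ∨ x ≡ 𝟙
  good-split {x} {y} good = equal ≼𝟙 (compare (‾ x) y
    (λ ‾x≼y → compare (‾ y) x
      (λ ‾y≼x → ⇒-top ‾y≼x ⨟ ∧-intro (≼𝟙 ⨟ ⇒-top (weaken ‾x≼y)) ≼-refl ⨟ ≡⇒≼ good ⨟ ∨-inr)
      (λ x≼‾y → ⇒-top (≼φ ⨟ ‾-anti x≼‾y ⨟ weaken (∧-intro ≼-refl ‾x≼y ⨟ disjoint)) ⨟ ∨-inl))
    (λ y≼‾x → ⇒-top (∧-intro y≼‾x ≼-refl ⨟ disjoint) ⨟ ∨-inl))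
    where
    disjoint : p ⊢ ‾ x ∧ y ≼ 𝟘
    disjoint = ≡⇒≼ (divisibility _ _) ⨟
      ⊗-mono (≡⇒≼ (trans (cong ‾_ (sym good)) (trans (‾+ x y) (⊗-comm _ _)))) ≼-refl ⨟
      ≡⇒≼ (⊗-assoc _ _ _) ⨟ ⊗-mono ≼-refl evalʳ ⨟ eval

  -- This is the only instance of associativity of + that is needed outside the MV-center.
  good-absorb : ∀ s → x + y ≡ x → (s + x) + y ≡ s + x
  good-absorb {x} {y} s good = equal
    (split (good-split good)
      (+-mono ≼-refl (‾-zero assume) ⨟ ≡⇒≼ (+-identityʳ _))
      (≼𝟙 ⨟ +-topʳ assume))
    x≼x+y

  good-decreasing : x + y ≡ x → p ⊢ y ≼ x
  good-decreasing good = y≼x+y ⨟ ≡⇒≼ good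

  -- Arithmetic of the MV-center.

  InA⇒fixed : InA x → φ x ≡ x
  InA⇒fixed (y , refl) = φ‾ y

  fixed⇒InA : φ x ≡ x → InA x
  fixed⇒InA fixed = _ , sym fixed

  InA-φ : ∀ x → InA (φ x)
  InA-φ x = ‾ x , refl

  InA-𝟘 : InA 𝟘
  InA-𝟘 = fixed⇒InA φ𝟘

  InA-‾ : ∀ x → InA (‾ x)
  InA-‾ x = x , refl

  InA-⊗ : InA x → InA y → InA (x ⊗ y)
  InA-⊗ {x} {y} x∈A y∈A =
    fixed⇒InA (trans (φ-⊗ x y) (cong₂ _⊗_ (InA⇒fixed x∈A) (InA⇒fixed y∈A)))

  InA-+ : InA x → InA y → InA (x + y)
  InA-+ {x} {y} x∈A y∈A =
    fixed⇒InA (trans (φ-+ x y) (cong₂ _+_ (InA⇒fixed x∈A) (InA⇒fixed y∈A)))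

  +-as-‾⊗ : InA x → InA y → x + y ≡ ‾ (‾ x ⊗ ‾ y)
  +-as-‾⊗ {x} {y} x∈A y∈A =
    trans (cong₂ _+_ (sym (InA⇒fixed x∈A)) (sym (InA⇒fixed y∈A))) (φ+φ x y)

  +-as-⇒ : InA x → InA y → x + y ≡ (‾ x ⇒ y)
  +-as-⇒ {x} {y} x∈A y∈A = trans (+-as-‾⊗ x∈A y∈A)
    (trans (‾⊗ (‾ x) (‾ y)) (cong (‾ x ⇒_) (InA⇒fixed y∈A)))

  ⊗+-as-⇒ : InA x → InA y → InA z → (x ⊗ y) + z ≡ ((x ⇒ ‾ y) ⇒ z)
  ⊗+-as-⇒ {x} {y} {z} x∈A y∈A z∈A =
    trans (+-as-⇒ (InA-⊗ x∈A y∈A) z∈A) (cong (_⇒ z) (‾⊗ x y))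

  +-assoc : InA x → InA y → InA z → (x + y) + z ≡ x + (y + z)
  +-assoc {x} {y} {z} x∈A y∈A z∈A = begin
    (x + y) + z               ≡⟨ +-as-‾⊗ (InA-+ x∈A y∈A) z∈A ⟩
    ‾ (‾ (x + y) ⊗ ‾ z)       ≡⟨ cong (λ u → ‾ (u ⊗ ‾ z)) (‾+ x y) ⟩
    ‾ ((‾ x ⊗ ‾ y) ⊗ ‾ z)     ≡⟨ cong ‾_ (⊗-assoc _ _ _) ⟩
    ‾ (‾ x ⊗ (‾ y ⊗ ‾ z))     ≡⟨ cong (λ u → ‾ (‾ x ⊗ u)) (‾+ y z) ⟨
    ‾ (‾ x ⊗ ‾ (y + z))       ≡⟨ +-as-‾⊗ x∈A (InA-+ y∈A z∈A) ⟨
    x + (y + z)               ∎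
    where open ≡-Reasoning

  -- Either `‾ x ≤ y` and the sum is `𝟙`, or `y ≤ ‾ x` and the product is `𝟘`.
  +⊗-good : InA x → InA y → (x + y) + (x ⊗ y) ≡ x + y
  +⊗-good {x} {y} x∈A y∈A = equal
    (compare (‾ x) y
      (λ ‾x≼y → ≼𝟙 ⨟ ⇒-top ‾x≼y ⨟ ≡⇒≼ (sym (+-as-⇒ x∈A y∈A)))
      (λ y≼‾x → +-mono ≼-refl (swap⊗ ⨟ uncurry y≼‾x) ⨟ ≡⇒≼ (+-identityʳ _)))
    x≼x+y

  +‾ : InA x → x + ‾ x ≡ 𝟙
  +‾ x∈A = equal ≼𝟙 (⇒-top ≼-refl ⨟ ≡⇒≼ (sym (+-as-⇒ x∈A (InA-‾ _))))

  ⊗‾ : ∀ x → x ⊗ ‾ x ≡ 𝟘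
  ⊗‾ x = equal evalʳ 𝟘≼

  -- Together with `φ⊗δ` this yields `(φ x) + (δ x) = (1, x)` for one-term sequences.
  φ+δ : ∀ x → φ x + δ x ≡ 𝟙
  φ+δ x = equal ≼𝟙 (∧-intro
    (⇒-top (curry (⊗-mono (≡⇒≼ (φ‾ x)) ≼-refl ⨟ evalʳ ⨟ 𝟘≼)))
    (⇒-top (≡⇒≼ (trans (sym (φ‾ (δ x))) (cong ‾_ (φδ x))) ⨟ ‾-unit ≼-refl ⨟ 𝟘≼)))

  -- With q ≼ x this is the MV-identity (x ⇒ q) ⇒ q = x ∨ q.
  double-⇒ : InA x → InA q → p ⊢ q ≼ x → p ⊢ (x ⇒ q) ⇒ q ≼ x
  double-⇒ {x} {q} x∈A q∈A q≼x =
    ≡⇒≼ (begin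
      (x ⇒ q) ⇒ q               ≡⟨ cong (λ u → (x ⇒ u) ⇒ u) (InA⇒fixed q∈A) ⟨
      (x ⇒ φ q) ⇒ φ q           ≡⟨ ‾⊗ (x ⇒ φ q) (‾ q) ⟨
      ‾ ((x ⇒ φ q) ⊗ ‾ q)       ≡⟨ cong (λ u → ‾ (u ⊗ ‾ q)) (contrapose x (‾ q)) ⟩
      ‾ ((‾ q ⇒ ‾ x) ⊗ ‾ q)     ≡⟨ cong ‾_ (⊗-comm _ _) ⟩
      ‾ (‾ q ⊗ (‾ q ⇒ ‾ x))     ∎) ⨟
    ‾-anti (divide (‾-anti q≼x)) ⨟ ≡⇒≼ (InA⇒fixed x∈A)
    where open ≡-Reasoning

  -- Both `x` and `z` are compared with `q`. Below `q`, the residual of `x` into `q` is `𝟙` and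
  -- drops out; above `q`, divisibility factors `q` through the larger element, or `double-⇒`
  -- removes the two residuals.
  exchange : InA x → InA q → p ⊢ (x ⇒ q) ⇒ ((q ⇒ x) ⊗ z) ≼ (z ⇒ q) ⇒ ((q ⇒ z) ⊗ x)
  exchange {x} {q} {z = z} x∈A q∈A = compare q x
    (λ q≼x → compare q z
      (λ q≼z →
        ⇒-mono ≼-refl (⊗-snd ⨟ curry evalʳ) ⨟ ⇒-swap ⨟
        ⇒-mono ≼-refl (double-⇒ x∈A q∈A (weaken q≼x) ⨟ ⊗-unitˡ (⇒-top q≼z)))
      (λ z≼q →
        -- Here `z ≤ q ≤ x`. The element `w = (x ⇒ q) ⇒ z` lies below `x`, so `w = x ⊗ (x ⇒ w)`; and
        -- `x ⇒ w ≤ q ⇒ z` because `q = x ⊗ (x ⇒ q)`.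
        ⇒-mono ≼-refl ⊗-snd ⨟
        divide (⇒-mono ≼-refl z≼q ⨟ double-⇒ x∈A q∈A (weaken q≼x)) ⨟
        ⊗-mono ≼-refl (curry (⊗-mono ≼-refl (divide (weaken q≼x)) ⨟
          ≡⇒≼ (sym (⊗-assoc _ _ _)) ⨟ ⊗-mono eval ≼-refl ⨟ eval)) ⨟
        swap⊗ ⨟ curry ⊗-fst))
    (λ x≼q → compare q z
      (λ q≼z →
        ⇒-unit (⇒-top (weaken x≼q)) ⨟
        curry (≡⇒≼ (⊗-assoc _ _ _) ⨟ ⊗-mono ≼-refl evalʳ ⨟ eval ⨟ ⊗-unitˡ (⇒-top q≼z)))
      (λ z≼q →
        ⇒-unit (⇒-top (weaken x≼q)) ⨟
        ⊗-mono ≼-refl (divide z≼q) ⨟ ≡⇒≼ (sym (⊗-assoc _ _ _)) ⨟ ⊗-mono eval ≼-refl ⨟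
        swap⊗ ⨟ curry ⊗-fst))

  -- The entry of index 1 in the associativity law for one-term good sequences.
  ⊗+-exchange : InA x → InA y → InA z → (x ⊗ y) + ((x + y) ⊗ z) ≡ (z ⊗ y) + ((z + y) ⊗ x)
  ⊗+-exchange {x} {y} {z} x∈A y∈A z∈A = begin
    (x ⊗ y) + ((x + y) ⊗ z)             ≡⟨ expand x∈A z∈A ⟩
    (x ⇒ ‾ y) ⇒ ((‾ y ⇒ x) ⊗ z)         ≡⟨ equal (exchange x∈A (InA-‾ y)) (exchange z∈A (InA-‾ y)) ⟩
    (z ⇒ ‾ y) ⇒ ((‾ y ⇒ z) ⊗ x)         ≡⟨ expand z∈A x∈A ⟨
    (z ⊗ y) + ((z + y) ⊗ x)             ∎
    where
    open ≡-Reasoning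
    expand : ∀ {x z} → InA x → InA z →
             (x ⊗ y) + ((x + y) ⊗ z) ≡ ((x ⇒ ‾ y) ⇒ ((‾ y ⇒ x) ⊗ z))
    expand {x} {z} x∈A z∈A =
      trans (⊗+-as-⇒ x∈A y∈A (InA-⊗ (InA-+ x∈A y∈A) z∈A))
        (cong (λ u → (x ⇒ ‾ y) ⇒ (u ⊗ z)) (trans (+-comm x y) (+-as-⇒ y∈A x∈A)))

  -- Good sequences

  infix 3 _⊢_≈_
  _⊢_≈_ : Carrier → Carrier → Carrier → Set c
  p ⊢ x ≈ y = (p ⊢ x ≼ y) × (p ⊢ y ≼ x)

  ≈-refl : p ⊢ x ≈ x
  ≈-refl = ≼-refl , ≼-refl

  +-cong : p ⊢ x ≈ x′ → p ⊢ y ≈ y′ → p ⊢ x + y ≈ x′ + y′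
  +-cong (h , h′) (k , k′) = +-mono h k , +-mono h′ k′

  ⊗-cong : p ⊢ x ≈ x′ → p ⊢ y ≈ y′ → p ⊢ x ⊗ y ≈ x′ ⊗ y′
  ⊗-cong (h , h′) (k , k′) = ⊗-mono h k , ⊗-mono h′ k′

  φ-cong : p ⊢ x ≈ y → p ⊢ φ x ≈ φ y
  φ-cong (h , k) = φ-mono h , φ-mono k

  δ-cong : p ⊢ x ≈ y → p ⊢ δ x ≈ δ y
  δ-cong (h , k) = ⇒-mono (φ-mono k) h , ⇒-mono (φ-mono h) k

  infix 3 _⊢_≈ˢ_
  record _⊢_≈ˢ_ (p : Carrier) (a b : Seq) : Set c where
    constructor pointwise
    field at : ∀ i → p ⊢ a i ≈ b i
  open _⊢_≈ˢ_

  private variable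
    a b d e k : Seq

  ≈ˢ-refl : p ⊢ a ≈ˢ a
  ≈ˢ-refl = pointwise λ _ → ≈-refl

  infixr 5 _∷_
  _∷_ : Carrier → Seq → Seq
  (x ∷ a) zero = x
  (x ∷ a) (suc n) = a n

  tail : Seq → Seq
  tail a n = a (suc n)

  single : Carrier → Seq
  single x = x ∷ zeroSeq

  ∷-cong : x ≡ y → a ≡ˢ b → (x ∷ a) ≡ˢ (y ∷ b)
  ∷-cong h k zero = h
  ∷-cong h k (suc n) = k n

  single-cong : p ⊢ x ≈ y → p ⊢ single x ≈ˢ single y
  single-cong h = pointwise λ { zero → h ; (suc _) → ≈-refl }

  -- The fold defining (a ⊕ b) n, as a recursion that consumes b.
  conv : Seq → Seq → ℕ → Carrier → Carrier
  conv a b zero s = s + b 0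
  conv a b (suc n) s = conv a (tail b) n (s + a n ⊗ b 0)

  foldl-conv : ∀ a b n s →
    foldl _+_ s (map (λ k → a (n ∸ suc k) ⊗ b k) (upTo n) ++ [ b n ]) ≡ conv a b n s
  foldl-conv a b zero s = refl
  foldl-conv a b (suc n) s = trans
    (cong (λ ts → foldl _+_ (s + a n ⊗ b 0) (ts ++ [ b (suc n) ]))
      (trans (map-applyUpTo suc (λ k → a (suc n ∸ suc k) ⊗ b k) n) (sym (map-upTo _ n))))
    (foldl-conv a (tail b) n (s + a n ⊗ b 0))

  ⊕-conv : ∀ a b n → (a ⊕ b) n ≡ conv a b n (a n)
  ⊕-conv a b n = foldl-conv a b n (a n)

  conv-mono : ∀ {s t} → (∀ i → p ⊢ a i ≼ d i) → (∀ i → p ⊢ b i ≼ e i) → ∀ n → p ⊢ s ≼ t →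
              p ⊢ conv a b n s ≼ conv d e n t
  conv-mono h k zero s≼t = +-mono s≼t (k 0)
  conv-mono h k (suc n) s≼t =
    conv-mono h (λ i → k (suc i)) n (+-mono s≼t (⊗-mono (h n) (k 0)))

  ⊕-mono : (∀ i → p ⊢ a i ≼ d i) → (∀ i → p ⊢ b i ≼ e i) → ∀ n → p ⊢ (a ⊕ b) n ≼ (d ⊕ e) n
  ⊕-mono {a = a} {d} {b} {e} h k n =
    ≡⇒≼ (⊕-conv a b n) ⨟ conv-mono h k n (h n) ⨟ ≡⇒≼ (sym (⊕-conv d e n))

  ⊕-cong : p ⊢ a ≈ˢ d → p ⊢ b ≈ˢ e → p ⊢ a ⊕ b ≈ˢ d ⊕ e
  ⊕-cong h k = pointwise λ n →
      ⊕-mono (λ i → proj₁ (at h i)) (λ i → proj₁ (at k i)) n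
    , ⊕-mono (λ i → proj₂ (at h i)) (λ i → proj₂ (at k i)) n

  ⊕-mono-≤ : ∀ a d b e → a ≤ˢ d → b ≤ˢ e → (a ⊕ b) ≤ˢ (d ⊕ e)
  ⊕-mono-≤ a d b e h k n =
    exact (⊕-mono {a = a} {d} {b} {e} (λ i → lift (h i)) (λ i → lift (k i)) n)

  ⊕-cong-≡ : ∀ a d b e → a ≡ˢ d → b ≡ˢ e → (a ⊕ b) ≡ˢ (d ⊕ e)
  ⊕-cong-≡ a d b e h k n = ≤-antisym
    (⊕-mono-≤ a d b e (λ i → ≤-reflexive (h i)) (λ i → ≤-reflexive (k i)) n)
    (⊕-mono-≤ d a e b (λ i → ≤-reflexive (sym (h i))) (λ i → ≤-reflexive (sym (k i))) n)

  ⊕-congˡ : ∀ a b d → a ≡ˢ b → (a ⊕ d) ≡ˢ (b ⊕ d)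
  ⊕-congˡ a b d h = ⊕-cong-≡ a b d d h (λ _ → refl)

  ⊕-congʳ : ∀ a b d → b ≡ˢ d → (a ⊕ b) ≡ˢ (a ⊕ d)
  ⊕-congʳ a b d h = ⊕-cong-≡ a a b d (λ _ → refl) h

  zeroˡ : ∀ x → 𝟘 ⊗ x ≡ 𝟘
  zeroˡ x = equal ⊗-fst 𝟘≼

  +-⊗-zero : ∀ s x → s + x ⊗ 𝟘 ≡ s
  +-⊗-zero s x = trans (cong (s +_) (equal ⊗-snd 𝟘≼)) (+-identityʳ s)

  +-zero-⊗ : ∀ s x → s + 𝟘 ⊗ x ≡ s
  +-zero-⊗ s x = trans (cong (s +_) (zeroˡ x)) (+-identityʳ s)

  conv-zeroʳ : ∀ a b → b ≡ˢ zeroSeq → ∀ n s → conv a b n s ≡ s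
  conv-zeroʳ a b b≡0 zero s = trans (cong (s +_) (b≡0 0)) (+-identityʳ s)
  conv-zeroʳ a b b≡0 (suc n) s = trans (conv-zeroʳ a (tail b) (λ i → b≡0 (suc i)) n _)
    (trans (cong (λ t → s + a n ⊗ t) (b≡0 0)) (+-⊗-zero s (a n)))

  ⊕-identityʳ : ∀ a → (a ⊕ zeroSeq) ≡ˢ a
  ⊕-identityʳ a n = trans (⊕-conv a zeroSeq n) (conv-zeroʳ a zeroSeq (λ _ → refl) n (a n))

  ⊕-single-suc : ∀ a x n → (a ⊕ single x) (suc n) ≡ a (suc n) + a n ⊗ x
  ⊕-single-suc a x n = trans (⊕-conv a (single x) (suc n)) (conv-zeroʳ a zeroSeq (λ _ → refl) n _)

  single-⊕-single : ∀ x y → (single x ⊕ single y) ≡ˢ (x + y ∷ single (x ⊗ y))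
  single-⊕-single x y zero = refl
  single-⊕-single x y (suc zero) =
    trans (⊕-single-suc (single x) y 0) (trans (+-comm 𝟘 _) (+-identityʳ _))
  single-⊕-single x y (suc (suc n)) =
    trans (⊕-single-suc (single x) y (suc n)) (+-zero-⊗ 𝟘 y)

  -- Shifting by a leading `𝟙`, and induction on good sequences.

  Saturated : Seq → Set c
  Saturated a = ∀ i → a i + a (suc i) ≡ a i

  -- The leading `𝟙` only affects the end of the sum: the last two terms become `𝟙 ⊗ b n` and
  -- `b (suc n)`, and the second is absorbed by the first.
  conv-shift : ∀ a b → Saturated b → ∀ n s → conv (𝟙 ∷ a) b (suc n) s ≡ conv a b n s
  conv-shift a b sat zero s =
    trans (cong (λ t → (s + t) + b 1) (⊗-identityˡ (b 0))) (good-absorb s (sat 0))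
  conv-shift a b sat (suc n) s = conv-shift a (tail b) (λ i → sat (suc i)) n (s + a n ⊗ b 0)

  shiftˡ : ∀ a b → Saturated b → ((𝟙 ∷ a) ⊕ b) ≡ˢ (𝟙 ∷ (a ⊕ b))
  shiftˡ a b sat zero = 𝟙+ (b 0)
  shiftˡ a b sat (suc n) =
    trans (⊕-conv (𝟙 ∷ a) b (suc n)) (trans (conv-shift a b sat n (a n)) (sym (⊕-conv a b n)))

  shiftʳ : ∀ a b → Saturated a → (a ⊕ (𝟙 ∷ b)) ≡ˢ (𝟙 ∷ (a ⊕ b))
  shiftʳ a b sat zero = +𝟙 (a 0)
  shiftʳ a b sat (suc n) = begin
    (a ⊕ (𝟙 ∷ b)) (suc n)               ≡⟨ ⊕-conv a (𝟙 ∷ b) (suc n) ⟩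
    conv a b n (a (suc n) + a n ⊗ 𝟙)    ≡⟨ cong (λ t → conv a b n (a (suc n) + t)) (⊗-identityʳ (a n)) ⟩
    conv a b n (a (suc n) + a n)        ≡⟨ cong (conv a b n) (trans (+-comm _ _) (sat n)) ⟩
    conv a b n (a n)                    ≡⟨ ⊕-conv a b n ⟨
    (a ⊕ b) n                           ∎
    where open ≡-Reasoning

  VanishesFrom : ℕ → Seq → Set c
  VanishesFrom N a = ∀ r → N ≤ℕ r → a r ≡ 𝟘

  -- One induction principle thereby serves both monoids: `Q` is trivial for good sequences of `L`,
  -- and `GoodIn InA` unfolds to `InMA`.
  GoodIn : ∀ {ℓ} → (Carrier → Set ℓ) → Seq → Set _
  GoodIn Q a = IsGood a × (∀ i → Q (a i))

  IsGood-single : ∀ x → IsGood (single x)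
  IsGood-single x = (λ { zero → +-identityʳ x ; (suc _) → +-identityʳ 𝟘 }) , 1 , λ { (suc r) _ → refl }

  IsGood-tail : IsGood a → IsGood (tail a)
  IsGood-tail (sat , N , vanish) = (λ i → sat (suc i)) , N , λ r N≤r → vanish (suc r) (m≤n⇒m≤1+n N≤r)

  IsGood-zero : IsGood zeroSeq
  IsGood-zero = (λ _ → +-identityʳ 𝟘) , 0 , λ _ _ → refl

  -- The filter is arbitrary, so that `a` may be replaced under `f` by a form that it has only
  -- locally.
  Congruent : (Seq → Seq) → Set c
  Congruent f = ∀ {p a b} → p ⊢ a ≈ˢ b → p ⊢ f a ≈ˢ f b

  -- Since ‾ a₁ ∨ a₀ = 1, locally either a₁ = 0, and then a is single a₀, or a₀ = 1.
  good-cases : ∀ f g → Congruent f → Congruent g → Saturated a →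
               f (single (a 0)) ≡ˢ g (single (a 0)) → f (𝟙 ∷ tail a) ≡ˢ g (𝟙 ∷ tail a) →
               f a ≡ˢ g a
  good-cases {a} f g f-cong g-cong sat short long i = equal
    (split (good-split (sat 0)) (along f-cong g-cong (single-case assume) short)
                                (along f-cong g-cong (long-case assume) long))
    (split (good-split (sat 0)) (along g-cong f-cong (single-case assume) (λ j → sym (short j)))
                                (along g-cong f-cong (long-case assume) (λ j → sym (long j))))
    where
    along : ∀ {f g a′ p} → Congruent f → Congruent g → p ⊢ a ≈ˢ a′ → f a′ ≡ˢ g a′ →
            p ⊢ f a i ≼ g a i
    along f-cong g-cong h eq = proj₁ (at (f-cong h) i) ⨟ ≡⇒≼ (eq i) ⨟ proj₂ (at (g-cong h) i)
    below : ∀ {p} j → p ⊢ a (suc j) ≼ a 1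
    below zero = ≼-refl
    below (suc j) = good-decreasing (sat (suc j)) ⨟ below j
    single-case : ∀ {p} → p ⊢ 𝟙 ≼ ‾ (a 1) → p ⊢ a ≈ˢ single (a 0)
    single-case h = pointwise λ { zero → ≈-refl ; (suc j) → (below j ⨟ ‾-zero h) , 𝟘≼ }
    long-case : ∀ {p} → p ⊢ 𝟙 ≼ a 0 → p ⊢ a ≈ˢ 𝟙 ∷ tail a
    long-case h = pointwise λ { zero → ≼𝟙 , h ; (suc j) → ≈-refl }

  congruent-≡ : ∀ f → Congruent f → a ≡ˢ b → f a ≡ˢ f b
  congruent-≡ f f-cong h i = equal (proj₁ (at h′ i)) (proj₂ (at h′ i))
    where h′ = f-cong (pointwise λ i → ≡⇒≼ (h i) , ≡⇒≼ (sym (h i)))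

  -- By `good-cases` a good sequence is locally one-term or `𝟙 ∷ tail a`, and the tail has a smaller
  -- bound on its length.
  good-induction : ∀ {ℓ} (Q : Carrier → Set ℓ) f g → Congruent f → Congruent g →
    (∀ x → Q x → f (single x) ≡ˢ g (single x)) →
    (∀ a → GoodIn Q a → f a ≡ˢ g a → f (𝟙 ∷ a) ≡ˢ g (𝟙 ∷ a)) →
    ∀ a → GoodIn Q a → f a ≡ˢ g a
  good-induction Q f g f-cong g-cong base step = λ a a∈Q → go (proj₁ (proj₂ (proj₁ a∈Q))) a a∈Q
    (proj₂ (proj₂ (proj₁ a∈Q)))
    where
    go : ∀ N a → GoodIn Q a → VanishesFrom N a → f a ≡ˢ g a
    -- The zero sequence is treated as `single (a 0)`, since `Q` is known only for the entries of
    -- `a`.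
    go zero a (_ , q) vanish i = trans (congruent-≡ f f-cong a≡single i)
      (trans (base (a 0) (q 0) i) (sym (congruent-≡ g g-cong a≡single i)))
      where
      a≡single : a ≡ˢ single (a 0)
      a≡single zero = refl
      a≡single (suc r) = vanish (suc r) z≤n
    go (suc N) a (good , q) vanish = good-cases f g f-cong g-cong (proj₁ good)
      (base (a 0) (q 0))
      (step (tail a) tail∈Q (go N (tail a) tail∈Q λ r N≤r → vanish (suc r) (s≤s N≤r)))
      where
      tail∈Q : GoodIn Q (tail a)
      tail∈Q = IsGood-tail good , λ i → q (suc i)

  -- Induction on `a`, then on `b`. The shift lemmas handle a leading `𝟙` on either side, and for
  -- one-term sequences the claim is commutativity of `+` and `⊗`.
  ⊕-comm : IsGood a → IsGood b → (a ⊕ b) ≡ˢ (b ⊕ a)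
  ⊕-comm {a} {b} a-good b-good =
    good-induction (λ _ → ⊤) (_⊕ b) (b ⊕_) (λ h → ⊕-cong h ≈ˢ-refl) (⊕-cong ≈ˢ-refl)
      (λ x _ → single-comm x b (b-good , _))
      (λ a _ ih i → trans (shiftˡ a b (proj₁ b-good) i)
        (trans (∷-cong refl ih i) (sym (shiftʳ b a (proj₁ b-good) i))))
      a (a-good , _)
    where
    single-comm : ∀ x b → GoodIn (λ _ → ⊤) b → (single x ⊕ b) ≡ˢ (b ⊕ single x)
    single-comm x = good-induction (λ _ → ⊤) (single x ⊕_) (_⊕ single x)
      (⊕-cong ≈ˢ-refl) (λ h → ⊕-cong h ≈ˢ-refl)
      (λ y _ i → trans (single-⊕-single x y i)
        (trans (∷-cong (+-comm x y) (∷-cong (⊗-comm x y) λ _ → refl) i) (sym (single-⊕-single y x i))))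
      (λ b _ ih i → trans (shiftʳ (single x) b (proj₁ (IsGood-single x)) i)
        (trans (∷-cong refl ih i) (sym (shiftˡ b (single x) (proj₁ (IsGood-single x)) i))))

  ⊕-zeroʳ : ∀ a b → b ≡ˢ zeroSeq → (a ⊕ b) ≡ˢ a
  ⊕-zeroʳ a b b≡0 i = trans (⊕-congʳ a b zeroSeq b≡0 i) (⊕-identityʳ a i)

  ⊕-single-𝟙 : Saturated a → (a ⊕ single 𝟙) ≡ˢ (𝟙 ∷ a)
  ⊕-single-𝟙 {a} sat i = trans (shiftʳ a zeroSeq sat i) (∷-cong refl (⊕-identityʳ a) i)

  -- Good sequences of the MV-center

  -- When `M +ℕ N ≤ n`, each product has a factor beyond the bound of its sequence; consuming `M`
  -- entries of `b` leaves only zeros.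
  conv-vanishes : ∀ N M a b → VanishesFrom N a → VanishesFrom M b →
                  ∀ n s → M +ℕ N ≤ℕ n → s ≡ 𝟘 → conv a b n s ≡ 𝟘
  conv-vanishes N zero a b va vb n s _ s≡0 =
    trans (conv-zeroʳ a b (λ i → vb i z≤n) n s) s≡0
  conv-vanishes N (suc M) a b va vb (suc n) s (s≤s M+N≤n) s≡0 =
    conv-vanishes N M a (tail b) va (λ r M≤r → vb (suc r) (s≤s M≤r)) n _ M+N≤n
      (trans (cong₂ (λ t u → t + u ⊗ b 0) s≡0 (va n (≤ℕ-trans (m≤n+m N M) M+N≤n)))
        (+-zero-⊗ 𝟘 (b 0)))

  InMA-single : InA x → InMA (single x)
  InMA-single x∈A = IsGood-single _ , λ { zero → x∈A ; (suc _) → InA-𝟘 }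

  InMA-tail : InMA a → InMA (tail a)
  InMA-tail (good , a∈A) = IsGood-tail good , λ i → a∈A (suc i)

  saturated : InMA a → Saturated a
  saturated ((sat , _) , _) = sat

  InA-conv : ∀ a b → (∀ i → InA (a i)) → (∀ i → InA (b i)) → ∀ n s → InA s → InA (conv a b n s)
  InA-conv a b a∈A b∈A zero s s∈A = InA-+ s∈A (b∈A 0)
  InA-conv a b a∈A b∈A (suc n) s s∈A =
    InA-conv a (tail b) a∈A (λ i → b∈A (suc i)) n _ (InA-+ s∈A (InA-⊗ (a∈A n) (b∈A 0)))

  successive : Seq → Seq
  successive a i = a i + a (suc i)

  successive-cong : Congruent successive
  successive-cong h = pointwise λ i → +-cong (at h i) (at h (suc i))

  successive-𝟙∷ : a ≡ˢ (𝟙 ∷ b) → successive b ≡ˢ b → successive a ≡ˢ a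
  successive-𝟙∷ {a} eq sat zero = trans (cong (_+ a 1) (eq 0)) (trans (𝟙+ _) (sym (eq 0)))
  successive-𝟙∷ eq sat (suc i) =
    trans (cong₂ _+_ (eq (suc i)) (eq (suc (suc i)))) (trans (sat i) (sym (eq (suc i))))

  -- Induction in both arguments reduces this to the two-term sequence `(x + y, x ⊗ y)`, which is
  -- good by `+⊗-good`.
  ⊕-saturated : InMA a → InMA b → Saturated (a ⊕ b)
  ⊕-saturated {a} {b} a∈MA b∈MA =
    good-induction InA (λ a → successive (a ⊕ b)) (_⊕ b)
      (λ h → successive-cong (⊕-cong h ≈ˢ-refl)) (λ h → ⊕-cong h ≈ˢ-refl)
      (λ x x∈A → single-case x∈A b b∈MA)
      (λ a _ → successive-𝟙∷ (shiftˡ a b (saturated b∈MA)))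
      a a∈MA
    where
    single-case : InA x → ∀ b → InMA b → Saturated (single x ⊕ b)
    single-case {x} x∈A = good-induction InA (λ b → successive (single x ⊕ b)) (single x ⊕_)
      (λ h → successive-cong (⊕-cong ≈ˢ-refl h)) (⊕-cong ≈ˢ-refl)
      (λ y y∈A i → begin
        successive (single x ⊕ single y) i
          ≡⟨ congruent-≡ successive successive-cong (single-⊕-single x y) i ⟩
        successive (x + y ∷ single (x ⊗ y)) i
          ≡⟨ two-term y y∈A i ⟩
        (x + y ∷ single (x ⊗ y)) i
          ≡⟨ single-⊕-single x y i ⟨
        (single x ⊕ single y) i ∎)
      (λ b _ → successive-𝟙∷ (shiftʳ (single x) b (proj₁ (IsGood-single x))))
      where
      open ≡-Reasoning
      two-term : ∀ y → InA y → Saturated (x + y ∷ single (x ⊗ y))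
      two-term y y∈A zero = +⊗-good x∈A y∈A
      two-term y y∈A (suc i) = proj₁ (IsGood-single (x ⊗ y)) i

  InMA-⊕ : InMA a → InMA b → InMA (a ⊕ b)
  InMA-⊕ {a} {b} a∈MA@((_ , N , va) , a∈A) b∈MA@((_ , M , vb) , b∈A) =
    ( ⊕-saturated a∈MA b∈MA
    , M +ℕ N
    , λ r M+N≤r → trans (⊕-conv a b r)
        (conv-vanishes N M a b va vb r (a r) M+N≤r (va r (≤ℕ-trans (m≤n+m N M) M+N≤r))))
    , λ i → subst InA (sym (⊕-conv a b i)) (InA-conv a b a∈A b∈A i (a i) (a∈A i))

  -- Associativity over the MV-center.

  ⊕-assoc-single : InA x → InA y → InA z →
    ((single x ⊕ single y) ⊕ single z) ≡ˢ (single x ⊕ (single y ⊕ single z))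
  ⊕-assoc-single {x} {y} {z} x∈A y∈A z∈A = begin
    (single x ⊕ single y) ⊕ single z
      ≈⟨ ⊕-congˡ (single x ⊕ single y) (x + y ∷ single (x ⊗ y)) (single z) (single-⊕-single x y) ⟩
    (x + y ∷ single (x ⊗ y)) ⊕ single z
      ≈⟨ reversal ⟩
    (z + y ∷ single (z ⊗ y)) ⊕ single x
      ≈⟨ ⊕-congˡ (single z ⊕ single y) (z + y ∷ single (z ⊗ y)) (single x) (single-⊕-single z y) ⟨
    (single z ⊕ single y) ⊕ single x
      ≈⟨ ⊕-congˡ (single z ⊕ single y) (single y ⊕ single z) (single x)
           (⊕-comm (IsGood-single z) (IsGood-single y)) ⟩
    (single y ⊕ single z) ⊕ single x
      ≈⟨ ⊕-comm (proj₁ (InMA-⊕ (InMA-single y∈A) (InMA-single z∈A))) (IsGood-single x) ⟩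
    single x ⊕ (single y ⊕ single z) ∎
    where
    open SetoidReasoning (ℕ →-setoid Carrier)
    -- By commutativity it suffices that `x` and `z` can be interchanged. Both sides have at most
    -- three nonzero entries; the outer two are the sum and the product of all three elements, the
    -- middle one is `⊗+-exchange`.
    reversal : ((x + y ∷ single (x ⊗ y)) ⊕ single z) ≡ˢ ((z + y ∷ single (z ⊗ y)) ⊕ single x)
    reversal zero = trans (+-assoc x∈A y∈A z∈A) (trans (+-comm x _) (cong (_+ x) (+-comm y z)))
    reversal (suc zero) = trans (⊕-single-suc (x + y ∷ single (x ⊗ y)) z 0)
      (trans (⊗+-exchange x∈A y∈A z∈A) (sym (⊕-single-suc (z + y ∷ single (z ⊗ y)) x 0)))
    reversal (suc (suc zero)) = trans (⊕-single-suc (x + y ∷ single (x ⊗ y)) z 1)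
      (trans (cong (𝟘 +_) (xy∙z≈zy∙x x y z)) (sym (⊕-single-suc (z + y ∷ single (z ⊗ y)) x 1)))
    reversal (suc (suc (suc n))) = trans (⊕-single-suc (x + y ∷ single (x ⊗ y)) z (2 +ℕ n))
      (trans (cong (𝟘 +_) (trans (zeroˡ z) (sym (zeroˡ x))))
        (sym (⊕-single-suc (z + y ∷ single (z ⊗ y)) x (2 +ℕ n))))

  -- Three nested inductions, on `a`, `b` and `d`; a leading `𝟙` in any argument moves to the front
  -- of both sides.
  ⊕-assoc : InMA a → InMA b → InMA d → ((a ⊕ b) ⊕ d) ≡ˢ (a ⊕ (b ⊕ d))
  ⊕-assoc {a} {b} {d} a∈MA b∈MA d∈MA =
    good-induction InA (λ a → (a ⊕ b) ⊕ d) (_⊕ (b ⊕ d))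
      (λ h → ⊕-cong (⊕-cong h ≈ˢ-refl) ≈ˢ-refl) (λ h → ⊕-cong h ≈ˢ-refl)
      (λ x x∈A → first x∈A b b∈MA)
      (λ a _ ih → begin
        ((𝟙 ∷ a) ⊕ b) ⊕ d
          ≈⟨ ⊕-congˡ ((𝟙 ∷ a) ⊕ b) (𝟙 ∷ (a ⊕ b)) d (shiftˡ a b (saturated b∈MA)) ⟩
        (𝟙 ∷ (a ⊕ b)) ⊕ d       ≈⟨ shiftˡ (a ⊕ b) d (saturated d∈MA) ⟩
        𝟙 ∷ ((a ⊕ b) ⊕ d)       ≈⟨ ∷-cong refl ih ⟩
        𝟙 ∷ (a ⊕ (b ⊕ d))       ≈⟨ shiftˡ a (b ⊕ d) (⊕-saturated b∈MA d∈MA) ⟨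
        (𝟙 ∷ a) ⊕ (b ⊕ d)       ∎)
      a a∈MA
    where
    open SetoidReasoning (ℕ →-setoid Carrier)
    second : InA x → InA y → ∀ d → InMA d →
             ((single x ⊕ single y) ⊕ d) ≡ˢ (single x ⊕ (single y ⊕ d))
    second {x} {y} x∈A y∈A =
      good-induction InA ((single x ⊕ single y) ⊕_) (λ d → single x ⊕ (single y ⊕ d))
        (⊕-cong ≈ˢ-refl) (λ h → ⊕-cong ≈ˢ-refl (⊕-cong ≈ˢ-refl h))
        (λ z z∈A → ⊕-assoc-single x∈A y∈A z∈A)
        (λ d _ ih → begin
          (single x ⊕ single y) ⊕ (𝟙 ∷ d)
            ≈⟨ shiftʳ (single x ⊕ single y) d (⊕-saturated (InMA-single x∈A) (InMA-single y∈A)) ⟩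
          𝟙 ∷ ((single x ⊕ single y) ⊕ d)
            ≈⟨ ∷-cong refl ih ⟩
          𝟙 ∷ (single x ⊕ (single y ⊕ d))
            ≈⟨ shiftʳ (single x) (single y ⊕ d) (proj₁ (IsGood-single x)) ⟨
          single x ⊕ (𝟙 ∷ (single y ⊕ d))
            ≈⟨ ⊕-congʳ (single x) (single y ⊕ (𝟙 ∷ d)) (𝟙 ∷ (single y ⊕ d))
                 (shiftʳ (single y) d (proj₁ (IsGood-single y))) ⟨
          single x ⊕ (single y ⊕ (𝟙 ∷ d)) ∎)
    first : InA x → ∀ b → InMA b → ((single x ⊕ b) ⊕ d) ≡ˢ (single x ⊕ (b ⊕ d))
    first {x} x∈A =
      good-induction InA (λ b → (single x ⊕ b) ⊕ d) (λ b → single x ⊕ (b ⊕ d))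
        (λ h → ⊕-cong (⊕-cong ≈ˢ-refl h) ≈ˢ-refl) (λ h → ⊕-cong ≈ˢ-refl (⊕-cong h ≈ˢ-refl))
        (λ y y∈A → second x∈A y∈A d d∈MA)
        (λ b b∈MA ih → begin
          (single x ⊕ (𝟙 ∷ b)) ⊕ d
            ≈⟨ ⊕-congˡ (single x ⊕ (𝟙 ∷ b)) (𝟙 ∷ (single x ⊕ b)) d
                 (shiftʳ (single x) b (proj₁ (IsGood-single x))) ⟩
          (𝟙 ∷ (single x ⊕ b)) ⊕ d
            ≈⟨ shiftˡ (single x ⊕ b) d (saturated d∈MA) ⟩
          𝟙 ∷ ((single x ⊕ b) ⊕ d)
            ≈⟨ ∷-cong refl ih ⟩
          𝟙 ∷ (single x ⊕ (b ⊕ d))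
            ≈⟨ shiftʳ (single x) (b ⊕ d) (proj₁ (IsGood-single x)) ⟨
          single x ⊕ (𝟙 ∷ (b ⊕ d))
            ≈⟨ ⊕-congʳ (single x) ((𝟙 ∷ b) ⊕ d) (𝟙 ∷ (b ⊕ d)) (shiftˡ b d (saturated d∈MA)) ⟨
          single x ⊕ ((𝟙 ∷ b) ⊕ d) ∎)

  -- Cancellation over the MV-center.

  head⊕tail : InMA a → a ≡ˢ (single (a 0) ⊕ tail a)
  head⊕tail {a} a∈MA = good-cases (λ a → a) (λ a → single (a 0) ⊕ tail a)
    (λ h → h)
    (λ h → ⊕-cong (single-cong (at h 0)) (pointwise λ i → at h (suc i)))
    (saturated a∈MA)
    (λ i → sym (⊕-identityʳ (single (a 0)) i))
    (λ i → begin
      (𝟙 ∷ tail a) i           ≡⟨ ⊕-single-𝟙 (saturated (InMA-tail a∈MA)) i ⟨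
      (tail a ⊕ single 𝟙) i    ≡⟨ ⊕-comm (IsGood-tail (proj₁ a∈MA)) (IsGood-single 𝟙) i ⟩
      (single 𝟙 ⊕ tail a) i    ∎)
    where open ≡-Reasoning

  -- Since `(x) + (‾ x) = (1)`, adding `single (‾ x)` cancels `single x` up to a shift.
  ⊕-single-‾ : InMA a → InA x → ((a ⊕ single x) ⊕ single (‾ x)) ≡ˢ (𝟙 ∷ a)
  ⊕-single-‾ {a} {x} a∈MA x∈A = begin
    (a ⊕ single x) ⊕ single (‾ x)
      ≈⟨ ⊕-assoc a∈MA (InMA-single x∈A) (InMA-single (InA-‾ x)) ⟩
    a ⊕ (single x ⊕ single (‾ x))
      ≈⟨ ⊕-congʳ a (single x ⊕ single (‾ x)) (single 𝟙) single-‾ ⟩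
    a ⊕ single 𝟙
      ≈⟨ ⊕-single-𝟙 (saturated a∈MA) ⟩
    𝟙 ∷ a ∎
    where
    open SetoidReasoning (ℕ →-setoid Carrier)
    single-‾ : (single x ⊕ single (‾ x)) ≡ˢ single 𝟙
    single-‾ i = trans (single-⊕-single x (‾ x) i)
      (∷-cong (+‾ x∈A) (λ { zero → ⊗‾ x ; (suc _) → refl }) i)

  ≤ˢ-resp : ∀ a a′ b b′ → a ≡ˢ a′ → b ≡ˢ b′ → a ≤ˢ b → a′ ≤ˢ b′
  ≤ˢ-resp a a′ b b′ h k a≤b i = subst₂ _≤_ (h i) (k i) (a≤b i)

  ⊕-cancelʳ-≤ : InMA a → InMA b → InMA k → (a ⊕ k) ≤ˢ (b ⊕ k) → a ≤ˢ b
  ⊕-cancelʳ-≤ {a} {b} {k} a∈MA b∈MA k∈MA@((_ , N , vanish) , _) = go N a∈MA b∈MA k∈MA vanish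
    where
    go : ∀ {a b k} N → InMA a → InMA b → InMA k → VanishesFrom N k → (a ⊕ k) ≤ˢ (b ⊕ k) → a ≤ˢ b
    go {a} {b} {k} zero a∈MA b∈MA k∈MA vanish =
      ≤ˢ-resp (a ⊕ k) a (b ⊕ k) b (⊕-zeroʳ a k λ i → vanish i z≤n) (⊕-zeroʳ b k λ i → vanish i z≤n)
    -- The tail of `k` is cancelled by recursion from `a ⊕ k₀` and `b ⊕ k₀`. Adding `k₀′` then
    -- leaves `𝟙 ∷ a` and `𝟙 ∷ b`, which are compared at index `suc i`.
    go {a} {b} {k} (suc N) a∈MA b∈MA k∈MA vanish h i =
      ≤ˢ-resp ((a ⊕ k₀) ⊕ k₀′) (𝟙 ∷ a) ((b ⊕ k₀) ⊕ k₀′) (𝟙 ∷ b)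
        (⊕-single-‾ a∈MA (proj₂ k∈MA 0)) (⊕-single-‾ b∈MA (proj₂ k∈MA 0))
        (⊕-mono-≤ (a ⊕ k₀) (b ⊕ k₀) k₀′ k₀′
          (go N (InMA-⊕ a∈MA k₀∈MA) (InMA-⊕ b∈MA k₀∈MA) (InMA-tail k∈MA)
            (λ r N≤r → vanish (suc r) (s≤s N≤r))
            (≤ˢ-resp (a ⊕ k) ((a ⊕ k₀) ⊕ tail k) (b ⊕ k) ((b ⊕ k₀) ⊕ tail k)
              (regroup a∈MA) (regroup b∈MA) h))
          (λ _ → ≤-refl))
        (suc i)
      where
      k₀ k₀′ : Seq
      k₀ = single (k 0)
      k₀′ = single (‾ (k 0))
      k₀∈MA : InMA k₀
      k₀∈MA = InMA-single (proj₂ k∈MA 0)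
      regroup : ∀ {a} → InMA a → (a ⊕ k) ≡ˢ ((a ⊕ k₀) ⊕ tail k)
      regroup {a} a∈MA i = trans (⊕-congʳ a k (k₀ ⊕ tail k) (head⊕tail k∈MA) i)
        (sym (⊕-assoc a∈MA k₀∈MA (InMA-tail k∈MA) i))

  ⊕-cancelˡ-≤ : InMA k → InMA a → InMA b → (k ⊕ a) ≤ˢ (k ⊕ b) → a ≤ˢ b
  ⊕-cancelˡ-≤ {k} {a} {b} k∈MA a∈MA b∈MA h = ⊕-cancelʳ-≤ a∈MA b∈MA k∈MA
    (≤ˢ-resp (k ⊕ a) (a ⊕ k) (k ⊕ b) (b ⊕ k)
      (⊕-comm (proj₁ k∈MA) (proj₁ a∈MA)) (⊕-comm (proj₁ k∈MA) (proj₁ b∈MA)) h)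

  -- The retraction of good sequences onto those of the MV-center

  φˢ : Seq → Seq
  φˢ a i = φ (a i)

  φ-conv : ∀ a b n s → φ (conv a b n s) ≡ conv (φˢ a) (φˢ b) n (φ s)
  φ-conv a b zero s = φ-+ s (b 0)
  φ-conv a b (suc n) s = trans (φ-conv a (tail b) n _)
    (cong (conv (φˢ a) (φˢ (tail b)) n) (trans (φ-+ s _) (cong (φ s +_) (φ-⊗ (a n) (b 0)))))

  φˢ-⊕ : ∀ a b → φˢ (a ⊕ b) ≡ˢ (φˢ a ⊕ φˢ b)
  φˢ-⊕ a b n = trans (cong φ (⊕-conv a b n))
    (trans (φ-conv a b n (a n)) (sym (⊕-conv (φˢ a) (φˢ b) n)))

  φˢ-⊕-⊕ : ∀ a b k → φˢ ((a ⊕ b) ⊕ k) ≡ˢ ((φˢ a ⊕ φˢ b) ⊕ φˢ k)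
  φˢ-⊕-⊕ a b k i = trans (φˢ-⊕ (a ⊕ b) k i)
    (⊕-congˡ (φˢ (a ⊕ b)) (φˢ a ⊕ φˢ b) (φˢ k) (φˢ-⊕ a b) i)

  InMA-φˢ : IsGood a → InMA (φˢ a)
  InMA-φˢ {a} (sat , N , vanish) =
    ( (λ i → trans (sym (φ-+ (a i) (a (suc i)))) (cong φ (sat i)))
    , N , λ r N≤r → trans (cong φ (vanish r N≤r)) φ𝟘)
    , λ i → InA-φ (a i)

  φˢ-fixed : InMA a → φˢ a ≡ˢ a
  φˢ-fixed (_ , a∈A) i = InA⇒fixed (a∈A i)

  φˢ-single-dense : φ x ≡ 𝟙 → φˢ (single x) ≡ˢ single 𝟙
  φˢ-single-dense h zero = h
  φˢ-single-dense h (suc _) = φ𝟘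

  -- Under `φˢ` the witness `k` lands in the cancellative monoid over the MV-center and can be
  -- removed.
  φˢ-⪯ : IsGood a → IsGood b → IsGood d → IsGood e → (a , b) ⪯ (d , e) →
         (φˢ a ⊕ φˢ e) ≤ˢ (φˢ b ⊕ φˢ d)
  φˢ-⪯ {a} {b} {d} {e} ga gb gd ge (k , gk , h) =
    ⊕-cancelʳ-≤ (InMA-⊕ (InMA-φˢ ga) (InMA-φˢ ge)) (InMA-⊕ (InMA-φˢ gb) (InMA-φˢ gd)) (InMA-φˢ gk)
      (≤ˢ-resp (φˢ ((a ⊕ e) ⊕ k)) ((φˢ a ⊕ φˢ e) ⊕ φˢ k) (φˢ ((b ⊕ d) ⊕ k)) ((φˢ b ⊕ φˢ d) ⊕ φˢ k)
        (φˢ-⊕-⊕ a e k) (φˢ-⊕-⊕ b d k) (λ i → exact (φ-mono (lift (h i)))))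

  ∼⇒⪯ : (a , b) ∼ (d , e) → (a , b) ⪯ (d , e)
  ∼⇒⪯ (k , gk , h) = k , gk , λ i → ≤-reflexive (h i)

  ∼-flip : (a , b) ∼ (d , e) → (b , a) ∼ (e , d)
  ∼-flip (k , gk , h) = k , gk , λ i → sym (h i)

  -- The dense part of a good sequence

  -- For `N` beyond the support of the sequence this is the product of all `δ (a i)`, as `δ 𝟘 = 𝟙`.
  flag : ℕ → Seq → Carrier
  flag zero a = 𝟙
  flag (suc N) a = δ (a 0) ⊗ flag N (tail a)

  flag-cong : ∀ N → p ⊢ a ≈ˢ b → p ⊢ flag N a ≈ flag N b
  flag-cong zero h = ≈-refl
  flag-cong (suc N) h = ⊗-cong (δ-cong (at h 0)) (flag-cong N (pointwise λ i → at h (suc i)))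

  φ-flag : ∀ N a → φ (flag N a) ≡ 𝟙
  φ-flag zero a = φ𝟙
  φ-flag (suc N) a = trans (φ-⊗ _ _)
    (trans (cong₂ _⊗_ (φδ (a 0)) (φ-flag N (tail a))) (⊗-identityˡ 𝟙))

  δ𝟙 : δ 𝟙 ≡ 𝟙
  δ𝟙 = equal ≼𝟙 (⇒-top ≼𝟙)

  δ𝟘 : δ 𝟘 ≡ 𝟙
  δ𝟘 = equal ≼𝟙 (⇒-top (≡⇒≼ φ𝟘))

  flag-zero : ∀ N → flag N zeroSeq ≡ 𝟙
  flag-zero zero = refl
  flag-zero (suc N) = trans (cong₂ _⊗_ δ𝟘 (flag-zero N)) (⊗-identityˡ 𝟙)

  -- In a chain a = (1,…,1,x,0,…) with x = φ x or φ x = 1, and flag N a = δ x.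
  φˢ⊕flag : ∀ N → IsGood a → VanishesFrom N a → (φˢ a ⊕ single (flag N a)) ≡ˢ (𝟙 ∷ a)
  φˢ⊕flag {a} zero good vanish i =
    trans (⊕-single-𝟙 (saturated (InMA-φˢ good)) i) (∷-cong refl φˢa≡a i)
    where
    φˢa≡a : φˢ a ≡ˢ a
    φˢa≡a i = trans (cong φ (vanish i z≤n)) (trans φ𝟘 (sym (vanish i z≤n)))
  φˢ⊕flag {a} (suc N) good vanish =
    good-cases (λ a → φˢ a ⊕ single (flag (suc N) a)) (𝟙 ∷_)
      (λ h → ⊕-cong (pointwise λ i → φ-cong (at h i)) (single-cong (flag-cong (suc N) h)))
      (λ h → pointwise λ { zero → ≈-refl ; (suc i) → at h i })
      (proj₁ good) short long
    where
    open SetoidReasoning (ℕ →-setoid Carrier)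
    x₀ : Carrier
    x₀ = a 0
    short : (φˢ (single x₀) ⊕ single (flag (suc N) (single x₀))) ≡ˢ (𝟙 ∷ single x₀)
    short = begin
      φˢ (single x₀) ⊕ single (flag (suc N) (single x₀))
        ≈⟨ ⊕-cong-≡ (φˢ (single x₀)) (single (φ x₀)) (single (flag (suc N) (single x₀))) (single (δ x₀))
             (λ { zero → refl ; (suc _) → φ𝟘 })
             (∷-cong (trans (cong (δ x₀ ⊗_) (flag-zero N)) (⊗-identityʳ _)) λ _ → refl) ⟩
      single (φ x₀) ⊕ single (δ x₀)
        ≈⟨ single-⊕-single (φ x₀) (δ x₀) ⟩
      φ x₀ + δ x₀ ∷ single (φ x₀ ⊗ δ x₀)
        ≈⟨ ∷-cong (φ+δ x₀) (∷-cong (φ⊗δ x₀) λ _ → refl) ⟩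
      𝟙 ∷ single x₀ ∎
    t : Seq
    t = tail a
    long : (φˢ (𝟙 ∷ t) ⊕ single (flag (suc N) (𝟙 ∷ t))) ≡ˢ (𝟙 ∷ (𝟙 ∷ t))
    long = begin
      φˢ (𝟙 ∷ t) ⊕ single (flag (suc N) (𝟙 ∷ t))
        ≈⟨ ⊕-cong-≡ (φˢ (𝟙 ∷ t)) (𝟙 ∷ φˢ t) (single (flag (suc N) (𝟙 ∷ t))) (single (flag N t))
             (λ { zero → φ𝟙 ; (suc _) → refl })
             (∷-cong (trans (cong (_⊗ flag N t) δ𝟙) (⊗-identityˡ _)) λ _ → refl) ⟩
      (𝟙 ∷ φˢ t) ⊕ single (flag N t)
        ≈⟨ shiftˡ (φˢ t) (single (flag N t)) (proj₁ (IsGood-single _)) ⟩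
      𝟙 ∷ (φˢ t ⊕ single (flag N t))
        ≈⟨ ∷-cong refl (φˢ⊕flag N (IsGood-tail good) λ r N≤r → vanish (suc r) (s≤s N≤r)) ⟩
      𝟙 ∷ (𝟙 ∷ t) ∎

  denseFlag : IsGood a → Carrier
  denseFlag {a} (_ , N , _) = flag N a

  φ-denseFlag : (good : IsGood a) → φ (denseFlag good) ≡ 𝟙
  φ-denseFlag {a} (_ , N , _) = φ-flag N a

  φˢ⊕denseFlag : (good : IsGood a) → (φˢ a ⊕ single (denseFlag good)) ≡ˢ (𝟙 ∷ a)
  φˢ⊕denseFlag good@(_ , N , vanish) = φˢ⊕flag N good vanish

  -- The kernel of the retraction

  -- Cancellation over the MV-center makes this equality, stated without a witness `k`, the
  -- condition that `[φ a, φ b]` is zero.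
  Kernel : Pair → Set c
  Kernel (a , b) = φˢ a ≡ˢ φˢ b

  -- With equal images in the MV-center, only the dense parts can differ.
  ⊕-dense-bound : IsGood a → (gb : IsGood b) → Kernel (a , b) → x ≤ denseFlag gb →
                  (a ⊕ single x) ≤ˢ (b ⊕ single 𝟙)
  ⊕-dense-bound {a} {b} {x} ga gb a~b x≤flag =
    ≤ˢ-resp (a ⊕ single x) (a ⊕ single x) (φˢ b ⊕ single (denseFlag gb)) (b ⊕ single 𝟙)
      (λ _ → refl)
      (λ i → trans (φˢ⊕denseFlag gb i) (sym (⊕-single-𝟙 (proj₁ gb) i)))
      (⊕-mono-≤ a (φˢ b) (single x) (single (denseFlag gb))
        (λ i → subst (a i ≤_) (a~b i) (exact ≼φ))
        (λ { zero → x≤flag ; (suc _) → ≤-refl }))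

  ⪯-from-≤ : ∀ a b d e → (a ⊕ e) ≤ˢ (b ⊕ d) → (a , b) ⪯ (d , e)
  ⪯-from-≤ a b d e h = zeroSeq , IsGood-zero ,
    ⊕-mono-≤ (a ⊕ e) (b ⊕ d) zeroSeq zeroSeq h (λ _ → ≤-refl)

  ∼-from-≡ : ∀ a b d e → (a ⊕ e) ≡ˢ (b ⊕ d) → (a , b) ∼ (d , e)
  ∼-from-≡ a b d e h = zeroSeq , IsGood-zero , ⊕-congˡ (a ⊕ e) (b ⊕ d) zeroSeq h

  -- Each hypothesis `⪯`, moved to the MV-center, gives one inequality between `φˢ d` and `φˢ e`
  -- once the equal images of the outer pair are cancelled.
  Kernel-isConvex : IsConvex Kernel
  Kernel-isConvex (a , b) (d , e) (f , g) (ga , gb) (gd , ge) (gf , gg) a~b f~g x⪯y y⪯z i =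
    ≤-antisym (d≤e i) (e≤d i)
    where
    e≤d : φˢ e ≤ˢ φˢ d
    e≤d = ⊕-cancelˡ-≤ (InMA-φˢ gb) (InMA-φˢ ge) (InMA-φˢ gd)
      (≤ˢ-resp (φˢ a ⊕ φˢ e) (φˢ b ⊕ φˢ e) (φˢ b ⊕ φˢ d) (φˢ b ⊕ φˢ d)
        (⊕-congˡ (φˢ a) (φˢ b) (φˢ e) a~b) (λ _ → refl) (φˢ-⪯ ga gb gd ge x⪯y))
    d≤e : φˢ d ≤ˢ φˢ e
    d≤e = ⊕-cancelʳ-≤ (InMA-φˢ gd) (InMA-φˢ ge) (InMA-φˢ gg)
      (≤ˢ-resp (φˢ d ⊕ φˢ g) (φˢ d ⊕ φˢ g) (φˢ e ⊕ φˢ f) (φˢ e ⊕ φˢ g)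
        (λ _ → refl) (⊕-congʳ (φˢ e) (φˢ f) (φˢ g) f~g) (φˢ-⪯ gd ge gf gg y⪯z))

  Kernel-resp-∼ : ∀ x y → GoodPair x → GoodPair y → x ∼ y → Kernel x → Kernel y
  Kernel-resp-∼ (a , b) (d , e) (ga , gb) (gd , ge) x∼y a~b i =
    -- Exchanging the components of both pairs by `∼-flip` gives the reverse inequality.
    ≤-antisym (side gb ga ge gd (∼-flip x∼y) (λ i → sym (a~b i)) i) (side ga gb gd ge x∼y a~b i)
    where
    side : ∀ {a b d e} → IsGood a → IsGood b → IsGood d → IsGood e →
           (a , b) ∼ (d , e) → φˢ a ≡ˢ φˢ b → φˢ e ≤ˢ φˢ d
    side {a} {b} {d} {e} ga gb gd ge x∼y a~b = ⊕-cancelˡ-≤ (InMA-φˢ gb) (InMA-φˢ ge) (InMA-φˢ gd)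
      (≤ˢ-resp (φˢ a ⊕ φˢ e) (φˢ b ⊕ φˢ e) (φˢ b ⊕ φˢ d) (φˢ b ⊕ φˢ d)
        (⊕-congˡ (φˢ a) (φˢ b) (φˢ e) a~b) (λ _ → refl) (φˢ-⪯ ga gb gd ge (∼⇒⪯ x∼y)))

  Kernel-isSubgroup : IsSubgroup Kernel
  Kernel-isSubgroup = Kernel-resp-∼ , (λ _ → refl) , add , λ _ _ a~b i → sym (a~b i)
    where
    add : ∀ x y → GoodPair x → GoodPair y → Kernel x → Kernel y → Kernel (x +ᴾ y)
    add (a , b) (d , e) _ _ a~b d~e i = trans (φˢ-⊕ a d i)
      (trans (⊕-cong-≡ (φˢ a) (φˢ b) (φˢ d) (φˢ e) a~b d~e i) (sym (φˢ-⊕ b e i)))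

  dense-pair : φ x ≡ 𝟙 → φ y ≡ 𝟙 → Kernel (single x , single y)
  dense-pair x-dense y-dense i =
    trans (φˢ-single-dense x-dense i) (sym (φˢ-single-dense y-dense i))

  dense-⊗ : φ x ≡ 𝟙 → φ y ≡ 𝟙 → φ (x ⊗ y) ≡ 𝟙
  dense-⊗ x-dense y-dense = trans (φ-⊗ _ _) (trans (cong₂ _⊗_ x-dense y-dense) (⊗-identityˡ 𝟙))

  -- A supremum of two elements of the kernel lies between one of them and
  -- any upper bound in the kernel, so convexity applies; dually for infima.
  Kernel-isSublattice : IsSublattice Kernel
  Kernel-isSublattice = sup-closed , inf-closed
    where
    sup-closed : ∀ x y z → GoodPair x → GoodPair y → GoodPair z →
                 Kernel x → Kernel y → IsSup z x y → Kernel z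
    sup-closed (a , b) (d , e) z gx@(ga , gb) (gd , ge) gz a~b d~e (x⪯z , _ , least) =
      Kernel-isConvex (a , b) z β gx gz gβ a~b β∈Kernel x⪯z
        (least β gβ
          (⪯-from-≤ a b (single 𝟙) (single s) (⊕-dense-bound ga gb a~b (x⊗y≤x _)))
          (⪯-from-≤ d e (single 𝟙) (single s) (⊕-dense-bound gd ge d~e (x⊗y≤y _))))
      where
      -- The product lies below both dense parts and is again dense, so one pair bounds both
      -- elements from above.
      s : Carrier
      s = denseFlag gb ⊗ denseFlag ge
      β : Pair
      β = single 𝟙 , single s
      gβ : GoodPair β
      gβ = IsGood-single 𝟙 , IsGood-single s
      β∈Kernel : Kernel β
      β∈Kernel = dense-pair φ𝟙 (dense-⊗ (φ-denseFlag gb) (φ-denseFlag ge))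
    inf-closed : ∀ x y z → GoodPair x → GoodPair y → GoodPair z →
                 Kernel x → Kernel y → IsInf z x y → Kernel z
    inf-closed (a , b) (d , e) z gx@(ga , gb) (gd , ge) gz a~b d~e (z⪯x , _ , greatest) =
      Kernel-isConvex β z (a , b) gβ gz gx β∈Kernel a~b
        (greatest β gβ (below ga gb a~b (x⊗y≤x _)) (below gd ge d~e (x⊗y≤y _))) z⪯x
      where
      s : Carrier
      s = denseFlag ga ⊗ denseFlag gd
      β : Pair
      β = single s , single 𝟙
      gβ : GoodPair β
      gβ = IsGood-single s , IsGood-single 𝟙
      β∈Kernel : Kernel β
      β∈Kernel = dense-pair (dense-⊗ (φ-denseFlag ga) (φ-denseFlag gd)) φ𝟙
      below : ∀ {a b} (ga : IsGood a) → IsGood b → Kernel (a , b) → s ≤ denseFlag ga → β ⪯ (a , b)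
      below {a} {b} ga gb a~b s≤flag = ⪯-from-≤ (single s) (single 𝟙) a b
        -- The bound for the negated pair `(b , a)`, with its summands commuted.
        (≤ˢ-resp (b ⊕ single s) (single s ⊕ b) (a ⊕ single 𝟙) (single 𝟙 ⊕ a)
          (⊕-comm gb (IsGood-single s)) (⊕-comm ga (IsGood-single 𝟙))
          (⊕-dense-bound gb ga (λ i → sym (a~b i)) s≤flag))

  Kernel-isComplement : IsComplementOfGA Kernel
  Kernel-isComplement = decompose , trivial-intersection
    where
    decompose : ∀ x → GoodPair x →
                Σ Pair λ y → Σ Pair λ z → InGA y × GoodPair z × Kernel z × (x ∼ (y +ᴾ z))
    decompose (a , b) (ga , gb) =
      (φˢ a , φˢ b) , (single (denseFlag ga) , single (denseFlag gb)) ,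
      (InMA-φˢ ga , InMA-φˢ gb) , (IsGood-single _ , IsGood-single _) ,
      dense-pair (φ-denseFlag ga) (φ-denseFlag gb) ,
      -- The sum of the two parts is `(𝟙 ∷ a , 𝟙 ∷ b)`. Both crosswise sums with `(a , b)` equal
      -- `𝟙 ∷ (a ⊕ b)`, so the zero sequence serves as `k`.
      ∼-from-≡ a b (φˢ a ⊕ single (denseFlag ga)) (φˢ b ⊕ single (denseFlag gb)) (begin
        a ⊕ (φˢ b ⊕ single (denseFlag gb))
          ≈⟨ ⊕-congʳ a (φˢ b ⊕ single (denseFlag gb)) (𝟙 ∷ b) (φˢ⊕denseFlag gb) ⟩
        a ⊕ (𝟙 ∷ b)     ≈⟨ shiftʳ a b (proj₁ ga) ⟩
        𝟙 ∷ (a ⊕ b)     ≈⟨ ∷-cong refl (⊕-comm ga gb) ⟩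
        𝟙 ∷ (b ⊕ a)     ≈⟨ shiftʳ b a (proj₁ gb) ⟨
        b ⊕ (𝟙 ∷ a)
          ≈⟨ ⊕-congʳ b (φˢ a ⊕ single (denseFlag ga)) (𝟙 ∷ a) (φˢ⊕denseFlag ga) ⟨
        b ⊕ (φˢ a ⊕ single (denseFlag ga)) ∎)
      where open SetoidReasoning (ℕ →-setoid Carrier)
    trivial-intersection : ∀ x → InGA x → Kernel x → x ∼ 0ᴾ
    trivial-intersection (a , b) (a∈MA , b∈MA) a~b = ∼-from-≡ a b zeroSeq zeroSeq
      (⊕-congˡ a b zeroSeq λ i → trans (sym (φˢ-fixed a∈MA i)) (trans (a~b i) (φˢ-fixed b∈MA i)))

  -- Equivalence over the MV-center and over `L`.

  ∼⇒∼A : InMA a → InMA b → InMA d → InMA e → (a , b) ∼ (d , e) → (a , b) ∼A (d , e)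
  -- Applying `φ` to the equation moves the witness into the MV-center and leaves the four given
  -- sequences unchanged.
  ∼⇒∼A {a} {b} {d} {e} a∈MA b∈MA d∈MA e∈MA (k , gk , h) = φˢ k , InMA-φˢ gk , λ i →
    trans (retract a∈MA e∈MA i) (trans (cong φ (h i)) (sym (retract b∈MA d∈MA i)))
    where
    retract : ∀ {a b} → InMA a → InMA b → ((a ⊕ b) ⊕ φˢ k) ≡ˢ φˢ ((a ⊕ b) ⊕ k)
    retract {a} {b} a∈MA b∈MA i = trans
      (⊕-congˡ (a ⊕ b) (φˢ a ⊕ φˢ b) (φˢ k)
        (⊕-cong-≡ a (φˢ a) b (φˢ b) (λ j → sym (φˢ-fixed a∈MA j)) (λ j → sym (φˢ-fixed b∈MA j))) i)
      (sym (φˢ-⊕-⊕ a b k i))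

theorem5p7 : ∀ {c} (L : BLAlgebra c) → let open BLDefs L in
    (∀ a b a′ b′ → InMA a → InMA b → InMA a′ → InMA b′ →
    ((a , b) ∼ (a′ , b′)) ⇔ ((a , b) ∼A (a′ , b′)))
    × Σ (Pair → Set c) (λ S → IsIdeal S × IsComplementOfGA S)
theorem5p7 L =
  (λ a b a′ b′ a∈ b∈ a′∈ b′∈ →
    mk⇔ (∼⇒∼A a∈ b∈ a′∈ b′∈) λ (k , (gk , _) , h) → k , gk , h)
  , Kernel , (Kernel-isSubgroup , Kernel-isSublattice , Kernel-isConvex) , Kernel-isComplement
  where open GoodSequences L
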